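{- For all integers $n\ge j\ge 0$, $$(-1)^{n}\mu_{2j,2}(-1,n)>0\qquad\text{and}\qquad (-1)^{n}\mu_{2j,3}(-1,n)>0.$$
   Context: A partition is a finite weakly decreasing (possibly empty) sequence of positive integers, called its parts; $\ell(\pi)$ denotes the number of parts of the partition $\pi$. For an integer $k\ge 2$, a $k$-colored partition of $n\ge 0$ is an ordered $k$-tuple $\overrightarrow{\pi}=(\pi^{(1)},\pi^{(2)},\dots,\pi^{(k)})$ of partitions (each possibly empty) such that the sum of all parts of all the $\pi^{(i)}$ equals $n$. Its $k$-crank is defined as $\ell(\pi^{(1)})-\ell(\pi^{(2)})$. For $m\in\mathbb{Z}$, $M_k(m,n)$ denotes the number of $k$-colored partitions of $n$ with $k$-crank equal to $m$; equivalently, $$\sum_{n\ge 0}\sum_{m\in\mathbb{Z}}M_k(m,n)z^mq^n=\frac{(q;q)_\infty^{2-k}}{(zq;q)_\infty(z^{ -1}q;q)_\infty},\qquad (a;q)_\infty:=\prod_{i\ge 0}(1-aq^i).$$ For integers $k\ge 2$ and $j,n\ge 0$, the $2j$-th symmetrized $k$-crank moment weighted by the parity of $k$-cranks is $$\mu_{2j,k}(-1,n):=\sum_{m=-n}^{n}\binom{m+j-1}{2j}(-1)^{m}M_{k}(m,n),$$ where the binomial coefficient is the generalized one, $\binom{x}{r}=\frac{x(x-1)\cdots(x-r+1)}{r!}$ for any integer $x$ (possibly negative) and $r\ge 0$, with $\binom{x}{0}=1$. -}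

module Defs where

open import Data.Integer as ℤ using (ℤ; +_; -[1+_]; 0ℤ; 1ℤ; -1ℤ; ∣_∣)
import Data.Integer.DivMod as ℤ
import Data.Integer.Properties as ℤ
open import Data.Integer.Tactic.RingSolver using (solve-∀)
open import Data.List as List
  using (List; []; _∷_; length; upTo; filter; foldr; cartesianProductWith)
import Data.List.Membership.Propositional.Properties as ∈
open import Data.List.Membership.Propositional using (_∈_)
import Data.List.Properties as List
open import Data.List.Relation.Unary.All as All using (All; []; _∷_)
open import Data.List.Relation.Unary.AllPairs using ([]; _∷_)
open import Data.List.Relation.Unary.Any using (here; there)
open import Data.List.Relation.Unary.Linked using (Linked; linked?)
open import Data.List.Relation.Unary.Unique.Propositional using (Unique)
import Data.List.Relation.Unary.Unique.Propositional.Properties as Unique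
open import Data.Nat as ℕ using
  (ℕ; zero; suc; _+_; _*_; _≤_; _<_; _≥_; _!; NonZero; NonTrivial; z≤n; s≤s)
open import Data.Nat.Divisibility using (divides; >⇒∤)
import Data.Nat.ListAction as ℕ
import Data.Nat.Properties as ℕ
open import Data.Product using (_×_; _,_; ∃; proj₁; proj₂)
open import Data.Vec as Vec using (Vec; []; _∷_)
import Data.Vec.Properties as Vec
import Data.Vec.Relation.Unary.All as VecAll
open import Function.Bundles using (_⇔_; mk⇔)
open import Relation.Binary.PropositionalEquality
open import Relation.Nullary using (Dec; contradiction)
open import Relation.Nullary.Decidable using (_×-dec_)

private
  variable
    A : Set

IsPartition : List ℕ → Set
IsPartition π = All (0 <_) π × Linked _≥_ π

isPartition? : ∀ π → Dec (IsPartition π)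
isPartition? π = All.all? (0 ℕ.<?_) π ×-dec linked? ℕ._≥?_ π

size : ∀ {k} → Vec (List ℕ) k → ℕ
size π = Vec.sum (Vec.map ℕ.sum π)

IsColoredPartition : (k n : ℕ) → Vec (List ℕ) k → Set
IsColoredPartition k n π = VecAll.All IsPartition π × size π ≡ n

isColoredPartition? : ∀ k n π → Dec (IsColoredPartition k n π)
isColoredPartition? k n π = VecAll.all? isPartition? π ×-dec size π ℕ.≟ n

crank : ∀ {k} .{{_ : NonTrivial k}} → Vec (List ℕ) k → ℤ
crank {{()}} []
crank {{()}} (_ ∷ [])
crank (π₁ ∷ π₂ ∷ _) = + length π₁ ℤ.- + length π₂

-- All lists of length at most l with entries in xs.
words : ℕ → List A → List (List A)
words zero    xs = [] ∷ []
words (suc l) xs = [] ∷ cartesianProductWith _∷_ xs (words l xs)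

-- All vectors of length k with entries in xs.
vectors : (k : ℕ) → List A → List (Vec A k)
vectors zero    xs = [] ∷ []
vectors (suc k) xs = cartesianProductWith _∷_ xs (vectors k xs)

-- Every component of a colored partition of n has at most n parts, each at
-- most n, so the search space below is exhaustive; ∈-coloredPartitions and
-- coloredPartitions-unique show that each colored partition of n is listed
-- exactly once.
coloredPartitions : (k n : ℕ) → List (Vec (List ℕ) k)
coloredPartitions k n =
  filter (isColoredPartition? k n) (vectors k (words n (upTo (suc n))))

M : (k : ℕ) .{{_ : NonTrivial k}} → ℤ → ℕ → ℕ
M k m n = length (filter (λ π → crank π ℤ.≟ m) (coloredPartitions k n))

-- x (x - 1) ⋯ (x - r + 1)
fallingFactorial : ℤ → ℕ → ℤ
fallingFactorial x zero    = 1ℤ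
fallingFactorial x (suc r) = fallingFactorial x r ℤ.* (x ℤ.- + r)

-- The division is exact, see binomial-exact.
binomial : ℤ → ℕ → ℤ
binomial x r = (fallingFactorial x r ℤ./ℕ (r !)) {{r ℕ.!≢0}}

sumℤ : List ℤ → ℤ
sumℤ = foldr ℤ._+_ 0ℤ

-- The integers from - n to n.
range : ℕ → List ℤ
range n = List.map (λ i → + i ℤ.- + n) (upTo (suc (2 * n)))

-- (-1)^m is written with ∣ m ∣, as m may be negative.
μ-term : (j k : ℕ) .{{_ : NonTrivial k}} → ℕ → ℤ → ℤ
μ-term j k n m =
  binomial (m ℤ.+ + j ℤ.- 1ℤ) (2 * j) ℤ.* -1ℤ ℤ.^ ∣ m ∣ ℤ.* + M k m n

-- μ j k n is μ_{2j,k}(-1,n): the first argument is half the index.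
μ : (j k : ℕ) .{{_ : NonTrivial k}} → ℕ → ℤ
μ j k n = sumℤ (List.map (μ-term j k n) (range n))

∈-words : ∀ l {xs : List A} {w} → length w ≤ l → All (_∈ xs) w → w ∈ words l xs
∈-words zero    {w = []}    _       _        = here refl
∈-words (suc l) {w = []}    _       _        = here refl
∈-words (suc l) {w = _ ∷ _} (s≤s p) (x ∷ ws) =
  there (∈.∈-cartesianProductWith⁺ _∷_ x (∈-words l p ws))

words-unique : ∀ l {xs : List A} → Unique xs → Unique (words l xs)
words-unique zero    _       = [] ∷ []
words-unique (suc l) {xs} xs! =
  All.tabulate nonempty ∷
  Unique.cartesianProductWith⁺ _∷_ List.∷-injective xs! (words-unique l xs!)
  where
  nonempty : ∀ {w} → w ∈ cartesianProductWith _∷_ xs (words l xs) → [] ≢ w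
  nonempty w∈ refl with ∈.∈-cartesianProductWith⁻ _∷_ xs (words l xs) w∈
  ... | _ , _ , _ , _ , ()

∈-vectors : ∀ {k} {xs : List A} {v : Vec A k} →
            VecAll.All (_∈ xs) v → v ∈ vectors k xs
∈-vectors VecAll.[]       = here refl
∈-vectors (x VecAll.∷ vs) = ∈.∈-cartesianProductWith⁺ _∷_ x (∈-vectors vs)

vectors-unique : ∀ k {xs : List A} → Unique xs → Unique (vectors k xs)
vectors-unique zero    _   = [] ∷ []
vectors-unique (suc k) xs! =
  Unique.cartesianProductWith⁺ _∷_ Vec.∷-injective xs! (vectors-unique k xs!)

length≤sum : ∀ {π} → All (0 <_) π → length π ≤ ℕ.sum π
length≤sum []       = z≤n
length≤sum (p ∷ ps) = ℕ.+-mono-≤ p (length≤sum ps)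

entries≤ : ∀ π {n} → ℕ.sum π ≤ n → All (_∈ upTo (suc n)) π
entries≤ []      _ = []
entries≤ (p ∷ π) h =
  ∈.∈-upTo⁺ (s≤s (ℕ.m+n≤o⇒m≤o p h)) ∷ entries≤ π (ℕ.m+n≤o⇒n≤o p h)

components∈ : ∀ {k n} {π : Vec (List ℕ) k} → VecAll.All IsPartition π →
              size π ≤ n → VecAll.All (_∈ words n (upTo (suc n))) π
components∈ VecAll.[] _ = VecAll.[]
components∈ {n = n} {π = π ∷ _} ((pos , _) VecAll.∷ ps) h =
  ∈-words n (ℕ.≤-trans (length≤sum pos) π≤n) (entries≤ π π≤n)
  VecAll.∷ components∈ ps (ℕ.m+n≤o⇒n≤o (ℕ.sum π) h)
  where
  π≤n : ℕ.sum π ≤ n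
  π≤n = ℕ.m+n≤o⇒m≤o (ℕ.sum π) h

∈-coloredPartitions : ∀ k n {π} →
                      π ∈ coloredPartitions k n ⇔ IsColoredPartition k n π
∈-coloredPartitions k n = mk⇔
  (λ π∈ → proj₂ (∈.∈-filter⁻ (isColoredPartition? k n)
                   {xs = vectors k (words n (upTo (suc n)))} π∈))
  (λ p → ∈.∈-filter⁺ (isColoredPartition? k n)
           (∈-vectors (components∈ (proj₁ p) (ℕ.≤-reflexive (proj₂ p)))) p)

coloredPartitions-unique : ∀ k n → Unique (coloredPartitions k n)
coloredPartitions-unique k n = Unique.filter⁺ (isColoredPartition? k n)
  (vectors-unique k (words-unique n (Unique.upTo⁺ (suc n))))

fallingFactorial-suc : ∀ x r →
  fallingFactorial (1ℤ ℤ.+ x) (suc r) ≡ (1ℤ ℤ.+ x) ℤ.* fallingFactorial x r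
fallingFactorial-suc x zero    = lemma x
  where
  lemma : ∀ x → 1ℤ ℤ.* ((1ℤ ℤ.+ x) ℤ.- 0ℤ) ≡ (1ℤ ℤ.+ x) ℤ.* 1ℤ
  lemma = solve-∀
fallingFactorial-suc x (suc r) = trans
  (cong (ℤ._* (1ℤ ℤ.+ x ℤ.- + suc r)) (fallingFactorial-suc x r))
  (lemma x (fallingFactorial x r) (+ r))
  where
  lemma : ∀ x f r → (1ℤ ℤ.+ x) ℤ.* f ℤ.* (1ℤ ℤ.+ x ℤ.- (1ℤ ℤ.+ r)) ≡
                    (1ℤ ℤ.+ x) ℤ.* (f ℤ.* (x ℤ.- r))
  lemma = solve-∀

fallingFactorial-pascal : ∀ x r →
  fallingFactorial (1ℤ ℤ.+ x) (suc r) ≡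
  fallingFactorial x (suc r) ℤ.+ + suc r ℤ.* fallingFactorial x r
fallingFactorial-pascal x r = trans
  (fallingFactorial-suc x r) (lemma x (fallingFactorial x r) (+ r))
  where
  lemma : ∀ x f r → (1ℤ ℤ.+ x) ℤ.* f ≡ f ℤ.* (x ℤ.- r) ℤ.+ (1ℤ ℤ.+ r) ℤ.* f
  lemma = solve-∀

factorial∣fallingFactorial : ∀ r x → ∃ λ c → fallingFactorial x r ≡ c ℤ.* + (r !)
factorial∣fallingFactorial zero    x = 1ℤ , refl
factorial∣fallingFactorial (suc r) = go
  where
  D : ℤ → Set
  D x = ∃ λ c → fallingFactorial x (suc r) ≡ c ℤ.* + (suc r !)

  f! : + (suc r !) ≡ + suc r ℤ.* + (r !)
  f! = ℤ.pos-* (suc r) (r !)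

  up : ∀ x → D x → D (1ℤ ℤ.+ x)
  up x (c , p) with factorial∣fallingFactorial r x
  ... | d , q = c ℤ.+ d , (begin
    fallingFactorial (1ℤ ℤ.+ x) (suc r)
      ≡⟨ fallingFactorial-pascal x r ⟩
    fallingFactorial x (suc r) ℤ.+ + suc r ℤ.* fallingFactorial x r
      ≡⟨ cong₂ (λ a b → a ℤ.+ + suc r ℤ.* b) p q ⟩
    c ℤ.* + (suc r !) ℤ.+ + suc r ℤ.* (d ℤ.* + (r !))
      ≡⟨ lemma c d (+ (suc r !)) (+ suc r) (+ (r !)) ⟩
    c ℤ.* + (suc r !) ℤ.+ d ℤ.* (+ suc r ℤ.* + (r !))
      ≡⟨ cong (λ a → c ℤ.* + (suc r !) ℤ.+ d ℤ.* a) f! ⟨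
    c ℤ.* + (suc r !) ℤ.+ d ℤ.* + (suc r !)
      ≡⟨ ℤ.*-distribʳ-+ (+ (suc r !)) c d ⟨
    (c ℤ.+ d) ℤ.* + (suc r !) ∎)
    where
    open ≡-Reasoning
    lemma : ∀ c d F s f → c ℤ.* F ℤ.+ s ℤ.* (d ℤ.* f) ≡ c ℤ.* F ℤ.+ d ℤ.* (s ℤ.* f)
    lemma = solve-∀

  down : ∀ x → D (1ℤ ℤ.+ x) → D x
  down x (c , p) with factorial∣fallingFactorial r x
  ... | d , q = c ℤ.- d , (begin
    fallingFactorial x (suc r)
      ≡⟨ add-sub (fallingFactorial x (suc r)) (+ suc r ℤ.* fallingFactorial x r) ⟩
    fallingFactorial x (suc r) ℤ.+ + suc r ℤ.* fallingFactorial x r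
      ℤ.- + suc r ℤ.* fallingFactorial x r
      ≡⟨ cong (ℤ._- + suc r ℤ.* fallingFactorial x r) (fallingFactorial-pascal x r) ⟨
    fallingFactorial (1ℤ ℤ.+ x) (suc r) ℤ.- + suc r ℤ.* fallingFactorial x r
      ≡⟨ cong₂ (λ a b → a ℤ.- + suc r ℤ.* b) p q ⟩
    c ℤ.* + (suc r !) ℤ.- + suc r ℤ.* (d ℤ.* + (r !))
      ≡⟨ cong (λ a → c ℤ.* a ℤ.- + suc r ℤ.* (d ℤ.* + (r !))) f! ⟩
    c ℤ.* (+ suc r ℤ.* + (r !)) ℤ.- + suc r ℤ.* (d ℤ.* + (r !))
      ≡⟨ lemma c d (+ suc r) (+ (r !)) ⟩
    (c ℤ.- d) ℤ.* (+ suc r ℤ.* + (r !))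
      ≡⟨ cong ((c ℤ.- d) ℤ.*_) f! ⟨
    (c ℤ.- d) ℤ.* + (suc r !) ∎)
    where
    open ≡-Reasoning
    add-sub : ∀ a b → a ≡ a ℤ.+ b ℤ.- b
    add-sub = solve-∀
    lemma : ∀ c d s f → c ℤ.* (s ℤ.* f) ℤ.- s ℤ.* (d ℤ.* f) ≡ (c ℤ.- d) ℤ.* (s ℤ.* f)
    lemma = solve-∀

  go : ∀ x → D x
  go (+ zero)      = 0ℤ , fallingFactorial-suc -1ℤ r
  go (+ suc n)     = up (+ n) (go (+ n))
  go -[1+ zero ]   = down -1ℤ (go 0ℤ)
  go -[1+ suc n ]  = down -[1+ suc n ] (go -[1+ n ])

*d/ℕd : ∀ c d .{{_ : NonZero d}} → ((c ℤ.* + d) ℤ./ℕ d) ℤ.* + d ≡ c ℤ.* + d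
*d/ℕd c d = sym (begin
  c ℤ.* + d                   ≡⟨ split ⟩
  + r ℤ.+ q ℤ.* + d           ≡⟨ cong (λ a → + a ℤ.+ q ℤ.* + d) (zeroRemainder r r<d r≡) ⟩
  0ℤ ℤ.+ q ℤ.* + d            ≡⟨ ℤ.+-identityˡ _ ⟩
  q ℤ.* + d                   ∎)
  where
  open ≡-Reasoning
  r = (c ℤ.* + d) ℤ.%ℕ d
  q = (c ℤ.* + d) ℤ./ℕ d
  r<d = ℤ.n%ℕd<d (c ℤ.* + d) d
  split = ℤ.a≡a%ℕn+[a/ℕn]*n (c ℤ.* + d) d
  cancel : ∀ a b → a ≡ a ℤ.+ b ℤ.- b
  cancel = solve-∀
  factor : ∀ a b e → a ℤ.* e ℤ.- b ℤ.* e ≡ (a ℤ.- b) ℤ.* e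
  factor = solve-∀
  r≡ : r ≡ ∣ c ℤ.- q ∣ * d
  r≡ = trans (cong ∣_∣ (trans (cancel (+ r) (q ℤ.* + d))
         (trans (cong (ℤ._- q ℤ.* + d) (sym split)) (factor c q (+ d)))))
         (ℤ.abs-* (c ℤ.- q) (+ d))
  zeroRemainder : ∀ s → s < d → s ≡ ∣ c ℤ.- q ∣ * d → s ≡ 0
  zeroRemainder zero    _   _  = refl
  zeroRemainder (suc s) s<d eq = contradiction (divides ∣ c ℤ.- q ∣ eq) (>⇒∤ s<d)

binomial-exact : ∀ x r → binomial x r ℤ.* + (r !) ≡ fallingFactorial x r
binomial-exact x r with fallingFactorial x r | factorial∣fallingFactorial r x
... | _ | c , refl = *d/ℕd c (r !) {{r ℕ.!≢0}}

{-# OPTIONS --safe #-}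

-- Put x = z + z⁻¹ - 2.  Taking second central differences shows that the
-- functional z^m ↦ binomial (m + j - 1) (2j) reads off the coefficient of x^j,
-- so with y_i = (-q)^i the numbers (-1)^n μ j k n are the coefficients of
--   F = ∏_i 1 / ((1 + y_i)² + x y_i)          (k = 2)
-- times ∏_i 1 / (1 - y_i) (k = 3), where parts may be restricted to i ≤ N.
-- The logarithmic derivative L = x F' / F is the sum over i ≤ N of the series
-- Λ_i = - x y_i / ((1 + y_i)² + x y_i) = Σ (± 1)^m c_r(m) x^r q^{im}, with sign +
-- for odd and - for even i.  As c_r is increasing, coefficientwise
--   Λ_i ≥ Σ c_r(m) x^r q^{2im}                            (i odd),
--   Λ_i + Σ c_r(m) x^r q^{im} ≥ Σ c_r(m) x^r q^{2im}      (i even),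
-- and summing over i ≤ N gives L ≥ 0 for even N.  Hence j F_j = Σ_r L_r F_{j-r}
-- reduces positivity to j = 0, where modulo q^{N+1}, as in Euler's identity,
--   F_0 = ∏ (1 + q^{2i-1})²                   (k = 2),
--   F_0 = ∏ (1 + q^{2i-1}) / (1 - q^{2i})     (k = 3).

module Submission where

open import Defs
open import Algebra.Bundles using (CommutativeRing)
import Algebra.Construct.Pointwise as Pointwise
open import Data.Empty using (⊥)
open import Data.Fin using (Fin; zero; suc)
open import Data.Integer as ℤ using (ℤ; 0ℤ; 1ℤ; -1ℤ; ∣_∣; -[1+_])
import Data.Integer.Properties as ℤ
open import Data.Integer.Tactic.RingSolver using (solve-∀)
open import Data.List using (List; []; _∷_; _++_; map; filter; length)
import Data.List.Properties as List
open import Data.List.Membership.Propositional using (_∈_)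
import Data.List.Membership.Propositional.Properties as ∈
open import Data.List.Membership.Propositional.Properties.WithK using (unique∧set⇒bag)
open import Data.List.Relation.Binary.BagAndSetEquality using (∼bag⇒↭)
open import Data.List.Relation.Binary.Permutation.Propositional as ↭ using (_↭_)
open import Data.List.Relation.Unary.All as All using (All; []; _∷_)
open import Data.List.Relation.Unary.AllPairs using ([]; _∷_)
open import Data.List.Relation.Unary.Any using (here; there)
open import Data.List.Relation.Unary.Linked as Linked using ([-]; _∷_)
open import Data.List.Relation.Unary.Linked.Properties using (Linked⇒All)
open import Data.List.Relation.Unary.Unique.Propositional using (Unique)
import Data.List.Relation.Unary.Unique.Propositional.Properties as Unique
open import Data.Nat as ℕ using (ℕ; zero; suc; _≤_; _<_; _≥_; _!; z≤n; s≤s)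
open import Data.Nat.Divisibility using (_∣_; _∣?_; divides; divides-refl; >⇒∤)
import Data.Nat.ListAction as ℕ
import Data.Nat.Properties as ℕ
open import Data.Product using (_×_; _,_; ∃; proj₁; proj₂)
open import Data.Sum using (_⊎_; inj₁; inj₂)
open import Data.Vec using (Vec; []; _∷_; lookup; updateAt; _[_]≔_; replicate)
import Data.Vec.Properties as Vec
import Data.Vec.Relation.Unary.All as VecAll
open import Data.Vec.Relation.Binary.Pointwise.Inductive as VecPointwise
  using ([]; _∷_)
open import Function using (_∘_)
open import Function.Bundles using (_⇔_; mk⇔; Equivalence)
open import Relation.Binary.PropositionalEquality as ≡ using (_≡_; _≢_)
open import Relation.Nullary using (Dec; contradiction; ¬_)
open import Relation.Nullary.Decidable using (yes; no)

-- Formal power series over a commutative ring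

-- Bounding the parts by N makes F a finite product and allows an induction on N: deleting a largest
-- part expresses F for the bound N as a known factor times F for the bound N + 1. No series is ever
-- inverted; factors with constant term 1 are cancelled instead. The obstacle to L ≥ 0 is that Λ_i
-- has negative coefficients for even i. Write E_i = Σ c_r(m) x^r q^(im). Every i ≤ N yields E_(2i),
-- but each even i = 2h must borrow E_i = E_(2h) for it. The borrowed terms have h ≤ N/2, so they
-- are among the terms gained. Strict positivity comes from a single term of L, namely x q with
-- coefficient 1: it makes j + 1 times the coefficient of x^(j+1) q^(n+1) in F at least the
-- coefficient of x^j q^n. Each power of x thus costs one power of q, which is where j ≤ n enters.

module PowerSeries {c ℓ} (R : CommutativeRing c ℓ) where

  open CommutativeRing R
  open import Relation.Binary.Reasoning.Setoid setoid
  open import Algebra.Solver.Ring.NaturalCoefficients.Default commutativeSemiring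
    using (solve; _:+_; _:*_; _:=_)
  open import Algebra.Properties.Semiring.Mult semiring using (×-comm-*) renaming (_×_ to _·_)
  open import Algebra.Properties.AbelianGroup +-abelianGroup using (∙-cancelʳ)

  Series : Set c
  Series = ℕ → Carrier

  shiftLeft : Series → Series
  shiftLeft a n = a (suc n)

  infixl 7 _⊛_
  -- The Cauchy product, by recursion on the degree: splitting off the constant term of the left
  -- factor avoids sums over index ranges.
  _⊛_ : Series → Series → Series
  (a ⊛ b) zero    = a 0 * b 0
  (a ⊛ b) (suc n) = a 0 * b (suc n) + (shiftLeft a ⊛ b) n

  const : Carrier → Series
  const x zero    = x
  const x (suc n) = 0#

  infix 4 _≋_ _≈[_]_
  _≋_ : Series → Series → Set ℓ
  a ≋ b = ∀ n → a n ≈ b n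

  _≈[_]_ : Series → ℕ → Series → Set ℓ
  a ≈[ k ] b = ∀ {n} → n ℕ.≤ k → a n ≈ b n

  ⊛-cong-≤ : ∀ {a a′ b b′} k → a ≈[ k ] a′ → b ≈[ k ] b′ → a ⊛ b ≈[ k ] a′ ⊛ b′
  ⊛-cong-≤ k p q {zero}  h = *-cong (p h) (q h)
  ⊛-cong-≤ (suc k) p q {suc n} (s≤s h) = +-cong (*-cong (p z≤n) (q (s≤s h)))
    (⊛-cong-≤ k (λ i≤k → p (s≤s i≤k)) (λ i≤k → q (ℕ.m≤n⇒m≤1+n i≤k)) h)

  ⊛-cong : ∀ {a a′ b b′} → a ≋ a′ → b ≋ b′ → a ⊛ b ≋ a′ ⊛ b′
  ⊛-cong p q n = ⊛-cong-≤ n (λ {i} _ → p i) (λ {i} _ → q i) ℕ.≤-refl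

  ⊛-distribʳ : ∀ c a b → (λ n → a n + b n) ⊛ c ≋ (λ n → (a ⊛ c) n + (b ⊛ c) n)
  ⊛-distribʳ c a b zero    = distribʳ (c 0) (a 0) (b 0)
  ⊛-distribʳ c a b (suc n) = begin
    (a 0 + b 0) * c (suc n) + ((λ n → shiftLeft a n + shiftLeft b n) ⊛ c) n
      ≈⟨ +-congˡ (⊛-distribʳ c (shiftLeft a) (shiftLeft b) n) ⟩
    (a 0 + b 0) * c (suc n) + ((shiftLeft a ⊛ c) n + (shiftLeft b ⊛ c) n)
      ≈⟨ solve 5 (λ x y z u v → (x :+ y) :* z :+ (u :+ v) := (x :* z :+ u) :+ (y :* z :+ v)) refl
           (a 0) (b 0) (c (suc n)) _ _ ⟩
    (a ⊛ c) (suc n) + (b ⊛ c) (suc n) ∎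

  -- Mirror image of the defining equation, splitting off the constant term of the right factor;
  -- commutativity follows by comparing the two.
  ⊛-suc : ∀ a b n → (a ⊛ b) (suc n) ≈ (a ⊛ shiftLeft b) n + a (suc n) * b 0
  ⊛-suc a b zero    = refl
  ⊛-suc a b (suc n) = begin
    a 0 * b (suc (suc n)) + (shiftLeft a ⊛ b) (suc n)
      ≈⟨ +-congˡ (⊛-suc (shiftLeft a) b n) ⟩
    a 0 * b (suc (suc n)) + ((shiftLeft a ⊛ shiftLeft b) n + a (suc (suc n)) * b 0)
      ≈⟨ +-assoc _ _ _ ⟨
    (a ⊛ shiftLeft b) (suc n) + a (suc (suc n)) * b 0 ∎

  ⊛-comm : ∀ a b → a ⊛ b ≋ b ⊛ a
  ⊛-comm a b zero    = *-comm (a 0) (b 0)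
  ⊛-comm a b (suc n) = begin
    a 0 * b (suc n) + (shiftLeft a ⊛ b) n ≈⟨ +-cong (*-comm _ _) (⊛-comm (shiftLeft a) b n) ⟩
    b (suc n) * a 0 + (b ⊛ shiftLeft a) n ≈⟨ +-comm _ _ ⟩
    (b ⊛ shiftLeft a) n + b (suc n) * a 0 ≈⟨ ⊛-suc b a n ⟨
    (b ⊛ a) (suc n)                       ∎

  ⊛-distribˡ : ∀ c a b → c ⊛ (λ n → a n + b n) ≋ (λ n → (c ⊛ a) n + (c ⊛ b) n)
  ⊛-distribˡ c a b n = begin
    (c ⊛ (λ n → a n + b n)) n ≈⟨ ⊛-comm c _ n ⟩
    ((λ n → a n + b n) ⊛ c) n ≈⟨ ⊛-distribʳ c a b n ⟩
    (a ⊛ c) n + (b ⊛ c) n     ≈⟨ +-cong (⊛-comm a c n) (⊛-comm b c n) ⟩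
    (c ⊛ a) n + (c ⊛ b) n     ∎

  ·-⊛ : ∀ x a b → (λ n → x * a n) ⊛ b ≋ (λ n → x * (a ⊛ b) n)
  ·-⊛ x a b zero    = *-assoc x (a 0) (b 0)
  ·-⊛ x a b (suc n) = begin
    x * a 0 * b (suc n) + ((λ n → x * shiftLeft a n) ⊛ b) n
      ≈⟨ +-cong (*-assoc _ _ _) (·-⊛ x (shiftLeft a) b n) ⟩
    x * (a 0 * b (suc n)) + x * (shiftLeft a ⊛ b) n
      ≈⟨ distribˡ _ _ _ ⟨
    x * (a ⊛ b) (suc n) ∎

  ⊛-assoc : ∀ a b c → (a ⊛ b) ⊛ c ≋ a ⊛ (b ⊛ c)
  ⊛-assoc a b c zero    = *-assoc (a 0) (b 0) (c 0)
  ⊛-assoc a b c (suc n) = begin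
    a 0 * b 0 * c (suc n) + ((λ n → a 0 * shiftLeft b n + (shiftLeft a ⊛ b) n) ⊛ c) n
      ≈⟨ +-congˡ (⊛-distribʳ c _ _ n) ⟩
    a 0 * b 0 * c (suc n) + (((λ n → a 0 * shiftLeft b n) ⊛ c) n + ((shiftLeft a ⊛ b) ⊛ c) n)
      ≈⟨ +-congˡ (+-cong (·-⊛ (a 0) (shiftLeft b) c n) (⊛-assoc (shiftLeft a) b c n)) ⟩
    a 0 * b 0 * c (suc n) + (a 0 * (shiftLeft b ⊛ c) n + (shiftLeft a ⊛ (b ⊛ c)) n)
      ≈⟨ solve 5 (λ x y z u v → x :* y :* z :+ (x :* u :+ v) := x :* (y :* z :+ u) :+ v) refl
           (a 0) (b 0) (c (suc n)) _ _ ⟩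
    a 0 * (b ⊛ c) (suc n) + (shiftLeft a ⊛ (b ⊛ c)) n ∎

  0⊛ : ∀ b → (λ _ → 0#) ⊛ b ≋ (λ _ → 0#)
  0⊛ b zero    = zeroˡ (b 0)
  0⊛ b (suc n) = trans (+-cong (zeroˡ (b (suc n))) (0⊛ b n)) (+-identityˡ 0#)

  const-⊛ : ∀ x b → const x ⊛ b ≋ (λ n → x * b n)
  const-⊛ x b zero    = refl
  const-⊛ x b (suc n) = trans (+-congˡ (0⊛ b n)) (+-identityʳ _)

  ⊛-identityˡ : ∀ b → const 1# ⊛ b ≋ b
  ⊛-identityˡ b n = trans (const-⊛ 1# b n) (*-identityˡ (b n))

  seriesRing : CommutativeRing c ℓ
  seriesRing = record
    { Carrier = Series
    ; _≈_ = _≋_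
    ; _+_ = λ a b n → a n + b n
    ; _*_ = _⊛_
    ; -_  = λ a n → - a n
    ; 0#  = λ _ → 0#
    ; 1#  = const 1#
    ; isCommutativeRing = record
      { isRing = record
        { +-isAbelianGroup = Pointwise.isAbelianGroup ℕ +-isAbelianGroup
        ; *-cong = ⊛-cong
        ; *-assoc = ⊛-assoc
        ; *-identity = ⊛-identityˡ , λ b n → trans (⊛-comm b (const 1#) n) (⊛-identityˡ b n)
        ; distrib = ⊛-distribˡ , ⊛-distribʳ
        }
      ; *-comm = ⊛-comm
      }
    }

  -- Once the lower coefficients of `a` and `b` agree, only the constant term of the left factor
  -- times the top coefficient remains to be compared. The left factors may differ beyond degree k,
  -- as `V (M * 2)` and `V M` do in Euler's identity.
  ⊛-cancelˡ-≤ : ∀ {p q a b} → (∀ x y → p 0 * x ≈ p 0 * y → x ≈ y) →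
                ∀ k → p ≈[ k ] q → p ⊛ a ≈[ k ] q ⊛ b → a ≈[ k ] b
  ⊛-cancelˡ-≤ cancel zero p≈q eq {zero} h =
    cancel _ _ (trans (eq h) (*-congʳ (sym (p≈q h))))
  ⊛-cancelˡ-≤ {p} {q} {a} {b} cancel (suc k) p≈q eq = go
    where
    ih : a ≈[ k ] b
    ih = ⊛-cancelˡ-≤ cancel k (λ h → p≈q (ℕ.m≤n⇒m≤1+n h)) (λ h → eq (ℕ.m≤n⇒m≤1+n h))
    rest : (shiftLeft p ⊛ a) k ≈ (shiftLeft q ⊛ b) k
    rest = ⊛-cong-≤ k (λ h → p≈q (s≤s h)) ih ℕ.≤-refl
    go : a ≈[ suc k ] b
    go h with ℕ.m≤n⇒m<n∨m≡n h
    ... | inj₁ (s≤s h′) = ih h′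
    ... | inj₂ ≡.refl = cancel _ _ (trans
      (∙-cancelʳ _ _ _ (trans (eq ℕ.≤-refl) (+-congˡ (sym rest))))
      (*-congʳ (sym (p≈q z≤n))))

  shift : ℕ → Series → Series
  shift zero    a n       = a n
  shift (suc i) a zero    = 0#
  shift (suc i) a (suc n) = shift i a n

  shift-cong : ∀ i {a b} → a ≋ b → shift i a ≋ shift i b
  shift-cong zero    p n       = p n
  shift-cong (suc i) p zero    = refl
  shift-cong (suc i) p (suc n) = shift-cong i p n

  shift-⊛ : ∀ i a b → shift i a ⊛ b ≋ shift i (a ⊛ b)
  shift-⊛ zero    a b n       = refl
  shift-⊛ (suc i) a b zero    = zeroˡ (b 0)
  shift-⊛ (suc i) a b (suc n) = begin
    0# * b (suc n) + (shift i a ⊛ b) n ≈⟨ +-cong (zeroˡ _) (shift-⊛ i a b n) ⟩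
    0# + shift i (a ⊛ b) n             ≈⟨ +-identityˡ _ ⟩
    shift i (a ⊛ b) n                  ∎

  X^ : ℕ → Series
  X^ i = shift i (const 1#)

  X^-⊛ : ∀ i a → X^ i ⊛ a ≋ shift i a
  X^-⊛ i a n = trans (shift-⊛ i (const 1#) a n) (shift-cong i (⊛-identityˡ a) n)

  -- The operator X d/dX, which unlike d/dX preserves degrees.
  θ : Series → Series
  θ a n = n · a n

  -- The Leibniz rule. Passing from `a` to `shiftLeft a` lowers the weights by one; the copy `v` of
  -- the product makes up for it.
  θ-⊛ : ∀ a b → θ (a ⊛ b) ≋ (λ n → (θ a ⊛ b) n + (a ⊛ θ b) n)
  θ-⊛ a b zero    = begin
    0#                          ≈⟨ +-identityˡ 0# ⟨
    0# + 0#                     ≈⟨ +-cong (zeroˡ (b 0)) (zeroʳ (a 0)) ⟨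
    0# * b 0 + a 0 * 0#         ∎
  θ-⊛ a b (suc n) = begin
    (u + v) + n · (u + v)
      ≈⟨ +-congˡ (×-distrib-+ u v n) ⟩
    (u + v) + (n · u + n · v)
      ≈⟨ +-congˡ (+-cong (sym (×-comm-* n _ _)) (θ-⊛ (shiftLeft a) b n)) ⟩
    (u + v) + (a 0 * (n · b (suc n)) + ((θ (shiftLeft a) ⊛ b) n + (shiftLeft a ⊛ θ b) n))
      ≈⟨ solve 6 (λ x y w v s t → (x :* y :+ v) :+ (x :* w :+ (s :+ t)) :=
                    (v :+ s) :+ (x :* (y :+ w) :+ t)) refl
           (a 0) (b (suc n)) (n · b (suc n)) v _ _ ⟩
    (v + (θ (shiftLeft a) ⊛ b) n) + (a ⊛ θ b) (suc n)
      ≈⟨ +-congʳ (⊛-distribʳ b (shiftLeft a) (θ (shiftLeft a)) n) ⟨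
    (shiftLeft (θ a) ⊛ b) n + (a ⊛ θ b) (suc n)
      ≈⟨ +-congʳ (trans (+-congʳ (zeroˡ _)) (+-identityˡ _)) ⟨
    (θ a ⊛ b) (suc n) + (a ⊛ θ b) (suc n) ∎
    where
    open import Algebra.Properties.CommutativeMonoid.Mult +-commutativeMonoid using (×-distrib-+)
    u = a 0 * b (suc n)
    v = (shiftLeft a ⊛ b) n

  shift-< : ∀ {i n} a → n ℕ.< i → shift i a n ≡ 0#
  shift-< {suc i} {zero}  a _       = ≡.refl
  shift-< {suc i} {suc n} a (s≤s h) = shift-< a h

  shift-+ : ∀ i a n → shift i a (i ℕ.+ n) ≡ a n
  shift-+ zero    a n = ≡.refl
  shift-+ (suc i) a n = shift-+ i a n

  linear : Carrier → Carrier → Series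
  linear x y zero          = x
  linear x y (suc zero)    = y
  linear x y (suc (suc n)) = 0#

  linear-⊛-suc : ∀ x y a n → (linear x y ⊛ a) (suc n) ≈ x * a (suc n) + y * a n
  linear-⊛-suc x y a n = +-congˡ (trans (⊛-cong tail≋const (λ _ → refl) n) (const-⊛ y a n))
    where
    tail≋const : shiftLeft (linear x y) ≋ const y
    tail≋const zero    = refl
    tail≋const (suc n) = refl

  ⊛-cancelˡ : ∀ {p a b} → (∀ x y → p 0 * x ≈ p 0 * y → x ≈ y) → p ⊛ a ≋ p ⊛ b → a ≋ b
  ⊛-cancelˡ cancel eq n = ⊛-cancelˡ-≤ cancel n (λ _ → refl) (λ {i} _ → eq i) ℕ.≤-refl

  θ-cong : ∀ {a b} → a ≋ b → θ a ≋ θ b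
  θ-cong p n = ×-congʳ n (p n)
    where open import Algebra.Properties.Semiring.Mult semiring using (×-congʳ)

  θ-const-⊛ : ∀ x b → θ (const x ⊛ b) ≋ const x ⊛ θ b
  θ-const-⊛ x b n = begin
    n · (const x ⊛ b) n  ≈⟨ θ-cong (const-⊛ x b) n ⟩
    n · (x * b n)        ≈⟨ ×-comm-* n x (b n) ⟨
    x * (n · b n)        ≈⟨ const-⊛ x (θ b) n ⟨
    (const x ⊛ θ b) n    ∎

  shift-shift : ∀ i j a → shift i (shift j a) ≋ shift (i ℕ.+ j) a
  shift-shift zero    j a n       = refl
  shift-shift (suc i) j a zero    = refl
  shift-shift (suc i) j a (suc n) = shift-shift i j a n

-- Colored partitions with bounded parts, and the weights of their cranks

module _ where

  open import Relation.Binary.PropositionalEquality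
  open ≡-Reasoning

  sumOver : ∀ {A : Set} → List A → (A → ℤ) → ℤ
  sumOver xs f = sumℤ (map f xs)

  sumOver-cong : ∀ {A : Set} (xs : List A) {f g : A → ℤ} → (∀ x → f x ≡ g x) → sumOver xs f ≡ sumOver xs g
  sumOver-cong xs p = cong sumℤ (List.map-cong p xs)

  sumOver-++ : ∀ {A : Set} (xs ys : List A) (f : A → ℤ) →
               sumOver (xs ++ ys) f ≡ sumOver xs f ℤ.+ sumOver ys f
  sumOver-++ []       ys f = sym (ℤ.+-identityˡ _)
  sumOver-++ (x ∷ xs) ys f =
    trans (cong (ℤ._+_ (f x)) (sumOver-++ xs ys f)) (sym (ℤ.+-assoc (f x) _ _))

  sumOver-map : ∀ {A B : Set} (h : A → B) (xs : List A) (f : B → ℤ) →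
                sumOver (map h xs) f ≡ sumOver xs (f ∘ h)
  sumOver-map h xs f = cong sumℤ (sym (List.map-∘ xs))

  sumOver-↭ : ∀ {A : Set} (f : A → ℤ) {xs ys} → xs ↭ ys → sumOver xs f ≡ sumOver ys f
  sumOver-↭ f ↭.refl         = refl
  sumOver-↭ f (↭.prep x p)   = cong (ℤ._+_ (f x)) (sumOver-↭ f p)
  sumOver-↭ f (↭.swap {xs} {ys} x y p) = begin
    f x ℤ.+ (f y ℤ.+ sumOver xs f) ≡⟨ ℤ.+-assoc (f x) (f y) _ ⟨
    f x ℤ.+ f y ℤ.+ sumOver xs f   ≡⟨ cong₂ ℤ._+_ (ℤ.+-comm (f x) (f y)) (sumOver-↭ f p) ⟩
    f y ℤ.+ f x ℤ.+ sumOver ys f   ≡⟨ ℤ.+-assoc (f y) (f x) _ ⟩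
    f y ℤ.+ (f x ℤ.+ sumOver ys f) ∎
  sumOver-↭ f (↭.trans p q)  = trans (sumOver-↭ f p) (sumOver-↭ f q)

  -- Duplicate-free lists with the same elements are permutations of each other, so bijections of
  -- partitions need only membership proofs, whatever the order of enumeration.
  sumOver-unique : ∀ {A : Set} (f : A → ℤ) {xs ys} → Unique xs → Unique ys →
                   (∀ {x} → x ∈ xs ⇔ x ∈ ys) → sumOver xs f ≡ sumOver ys f
  sumOver-unique f xs! ys! eq = sumOver-↭ f (∼bag⇒↭ (unique∧set⇒bag xs! ys! eq))

  -- Each color has its own bound, because the bounds are lowered one color at a time.
  BoundedBy : ∀ {k} → Vec ℕ k → Vec (List ℕ) k → Set
  BoundedBy = VecPointwise.Pointwise (λ m → All (_≤ m))

  boundedBy? : ∀ {k} (b : Vec ℕ k) π → Dec (BoundedBy b π)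
  boundedBy? = VecPointwise.decidable (λ m → All.all? (ℕ._≤? m))

  boundedPartitions : ∀ {k} → Vec ℕ k → ℕ → List (Vec (List ℕ) k)
  boundedPartitions {k} b n = filter (boundedBy? b) (coloredPartitions k n)

  boundedPartitions-unique : ∀ {k} (b : Vec ℕ k) n → Unique (boundedPartitions b n)
  boundedPartitions-unique {k} b n = Unique.filter⁺ (boundedBy? b) (coloredPartitions-unique k n)

  ∈-boundedPartitions : ∀ {k} (b : Vec ℕ k) n {π} →
    π ∈ boundedPartitions b n ⇔ (IsColoredPartition k n π × BoundedBy b π)
  ∈-boundedPartitions {k} b n = mk⇔
    (λ π∈ → let π∈′ , bounded = ∈.∈-filter⁻ (boundedBy? b) {xs = coloredPartitions k n} π∈
            in Equivalence.to (∈-coloredPartitions k n) π∈′ , bounded)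
    (λ (colored , bounded) →
      ∈.∈-filter⁺ (boundedBy? b) (Equivalence.from (∈-coloredPartitions k n) colored) bounded)

  -- Adding and removing a largest part of one color

  addPart : ∀ {k} → Fin k → ℕ → Vec (List ℕ) k → Vec (List ℕ) k
  addPart c i π = updateAt π c (i ∷_)

  addPart-injective : ∀ {k} (c : Fin k) i {π π′} → addPart c i π ≡ addPart c i π′ → π ≡ π′
  addPart-injective zero    i {π ∷ πs} {π′ ∷ πs′} eq with Vec.∷-injective eq
  ... | p , q = cong₂ _∷_ (List.∷-injectiveʳ p) q
  addPart-injective (suc c) i {π ∷ πs} {π′ ∷ πs′} eq with Vec.∷-injective eq
  ... | p , q = cong₂ _∷_ p (addPart-injective c i q)

  size-addPart : ∀ {k} (c : Fin k) i π → size (addPart c i π) ≡ i ℕ.+ size π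
  size-addPart zero    i (π ∷ πs) = ℕ.+-assoc i _ _
  size-addPart (suc c) i (π ∷ πs) = trans (cong (s ℕ.+_) (size-addPart c i πs)) (begin
    s ℕ.+ (i ℕ.+ size πs) ≡⟨ ℕ.+-assoc s i _ ⟨
    s ℕ.+ i ℕ.+ size πs   ≡⟨ cong (ℕ._+ size πs) (ℕ.+-comm s i) ⟩
    i ℕ.+ s ℕ.+ size πs   ≡⟨ ℕ.+-assoc i s _ ⟩
    i ℕ.+ (s ℕ.+ size πs) ∎)
    where
    s = ℕ.sum π

  partition-∷ : ∀ {m p} → 0 < m → All (_≤ m) p → IsPartition p → IsPartition (m ∷ p)
  partition-∷ 0<m []        (ps , _) = 0<m ∷ ps , [-]
  partition-∷ 0<m (h ∷ _)   (ps , l) = 0<m ∷ ps , h ∷ l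

  partition-tail : ∀ {m p} → IsPartition (m ∷ p) → IsPartition p
  partition-tail (_ ∷ ps , l) = ps , Linked.tail l

  parts≤head : ∀ {m x p} → x ≤ m → IsPartition (x ∷ p) → All (_≤ m) (x ∷ p)
  parts≤head x≤m (_ , l) = Linked⇒All (λ p q → ℕ.≤-trans q p) x≤m l

  module _ {i : ℕ} where

    boundedBy-suc : ∀ {k} (c : Fin k) (b : Vec ℕ k) {π} → lookup b c ≡ suc i →
                    BoundedBy (b [ c ]≔ i) π → BoundedBy b π
    boundedBy-suc zero    (_ ∷ b) refl (p ∷ ps) = All.map ℕ.m≤n⇒m≤1+n p ∷ ps
    boundedBy-suc (suc c) (_ ∷ b) eq   (p ∷ ps) = p ∷ boundedBy-suc c b eq ps

    addPart-unbounded : ∀ {k} (c : Fin k) (b : Vec ℕ k) {π} →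
                        BoundedBy (b [ c ]≔ i) (addPart c (suc i) π) → ⊥
    addPart-unbounded zero    (_ ∷ b) {_ ∷ _} ((h ∷ _) ∷ _) = ℕ.1+n≰n h
    addPart-unbounded (suc c) (_ ∷ b) {_ ∷ _} (_ ∷ ps)      = addPart-unbounded c b ps

    addPart-bounded : ∀ {k} (c : Fin k) (b : Vec ℕ k) {π} → lookup b c ≡ suc i →
      VecAll.All IsPartition π → BoundedBy b π →
      VecAll.All IsPartition (addPart c (suc i) π) × BoundedBy b (addPart c (suc i) π)
    addPart-bounded zero    (_ ∷ b) refl (q VecAll.∷ qs) (p ∷ ps) =
      partition-∷ (s≤s z≤n) p q VecAll.∷ qs , (ℕ.≤-refl ∷ p) ∷ ps
    addPart-bounded (suc c) (_ ∷ b) eq   (q VecAll.∷ qs) (p ∷ ps) =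
      let qs′ , ps′ = addPart-bounded c b eq qs ps in q VecAll.∷ qs′ , p ∷ ps′

    -- Parts decrease weakly, so it suffices to look at the head of component `c`: if it equals the
    -- bound, it is split off, and otherwise all parts of the component are at most `i`.
    bounded-split : ∀ {k} (c : Fin k) (b : Vec ℕ k) {π} → lookup b c ≡ suc i →
      VecAll.All IsPartition π → BoundedBy b π →
      BoundedBy (b [ c ]≔ i) π ⊎
      ∃ λ π′ → π ≡ addPart c (suc i) π′ × VecAll.All IsPartition π′ × BoundedBy b π′
    bounded-split zero (_ ∷ b) {[] ∷ _} refl (q VecAll.∷ qs) (p ∷ ps) = inj₁ ([] ∷ ps)
    bounded-split zero (_ ∷ b) {(x ∷ _) ∷ _} refl (q VecAll.∷ qs) ((h ∷ p) ∷ ps)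
      with ℕ.m≤n⇒m<n∨m≡n h
    ... | inj₁ (s≤s x≤i) = inj₁ (parts≤head x≤i q ∷ ps)
    ... | inj₂ refl      = inj₂ (_ , refl , partition-tail q VecAll.∷ qs , p ∷ ps)
    bounded-split (suc c) (_ ∷ b) eq (q VecAll.∷ qs) (p ∷ ps) with bounded-split c b eq qs ps
    ... | inj₁ ps′                      = inj₁ (p ∷ ps′)
    ... | inj₂ (_ , refl , qs′ , ps′)   = inj₂ (_ , refl , q VecAll.∷ qs′ , p ∷ ps′)

    module _ {k} (c : Fin k) (b : Vec ℕ k) (eq : lookup b c ≡ suc i) where

      private
        i+1 = suc i
        add = addPart c i+1

      -- Deleting one copy of the part i + 1 from component `c` is a bijection. The bound stays `b`
      -- in the last sum since that part may be repeated.
      boundedPartitions-split : ∀ n (f : Vec (List ℕ) k → ℤ) →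
        sumOver (boundedPartitions b (i+1 ℕ.+ n)) f ≡
        sumOver (boundedPartitions (b [ c ]≔ i) (i+1 ℕ.+ n)) f ℤ.+
        sumOver (boundedPartitions b n) (f ∘ add)
      boundedPartitions-split n f = begin
        sumOver (boundedPartitions b (i+1 ℕ.+ n)) f
          ≡⟨ sumOver-unique f (boundedPartitions-unique b (i+1 ℕ.+ n))
               (Unique.++⁺ (boundedPartitions-unique (b [ c ]≔ i) (i+1 ℕ.+ n))
                           (Unique.map⁺ (addPart-injective c i+1) (boundedPartitions-unique b n))
                           disjoint)
               (mk⇔ to from) ⟩
        sumOver (kept ++ map add (boundedPartitions b n)) f
          ≡⟨ sumOver-++ kept _ f ⟩
        sumOver kept f ℤ.+ sumOver (map add (boundedPartitions b n)) f
          ≡⟨ cong (ℤ._+_ (sumOver kept f)) (sumOver-map add (boundedPartitions b n) f) ⟩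
        sumOver kept f ℤ.+ sumOver (boundedPartitions b n) (f ∘ add) ∎
        where
        kept = boundedPartitions (b [ c ]≔ i) (i+1 ℕ.+ n)

        disjoint : ∀ {π} → π ∈ kept × π ∈ map add (boundedPartitions b n) → ⊥
        disjoint (π∈ , π∈′) with ∈.∈-map⁻ add π∈′
        ... | _ , _ , refl = addPart-unbounded c b
          (proj₂ (Equivalence.to (∈-boundedPartitions (b [ c ]≔ i) (i+1 ℕ.+ n)) π∈))

        to : ∀ {π} → π ∈ boundedPartitions b (i+1 ℕ.+ n) → π ∈ kept ++ map add (boundedPartitions b n)
        to π∈ with Equivalence.to (∈-boundedPartitions b (i+1 ℕ.+ n)) π∈
        ... | (qs , sz) , ps with bounded-split c b eq qs ps
        ... | inj₁ ps′ = ∈.∈-++⁺ˡ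
          (Equivalence.from (∈-boundedPartitions (b [ c ]≔ i) (i+1 ℕ.+ n)) ((qs , sz) , ps′))
        ... | inj₂ (π′ , refl , qs′ , ps′) = ∈.∈-++⁺ʳ kept (∈.∈-map⁺ add
          (Equivalence.from (∈-boundedPartitions b n)
            ((qs′ , ℕ.+-cancelˡ-≡ i+1 _ _ (trans (sym (size-addPart c i+1 π′)) sz)) , ps′)))

        from : ∀ {π} → π ∈ kept ++ map add (boundedPartitions b n) → π ∈ boundedPartitions b (i+1 ℕ.+ n)
        from π∈ with ∈.∈-++⁻ kept π∈
        ... | inj₁ π∈kept =
          let qs , ps = Equivalence.to (∈-boundedPartitions (b [ c ]≔ i) (i+1 ℕ.+ n)) π∈kept
          in Equivalence.from (∈-boundedPartitions b (i+1 ℕ.+ n)) (qs , boundedBy-suc c b eq ps)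
        ... | inj₂ π∈map with ∈.∈-map⁻ add π∈map
        ... | π′ , π′∈ , refl =
          let (qs , sz) , ps = Equivalence.to (∈-boundedPartitions b n) π′∈
              qs′ , ps′ = addPart-bounded c b eq qs ps
          in Equivalence.from (∈-boundedPartitions b (i+1 ℕ.+ n))
               ((qs′ , trans (size-addPart c i+1 π′) (cong (i+1 ℕ.+_) sz)) , ps′)

      boundedPartitions-small : ∀ {n} (f : Vec (List ℕ) k → ℤ) → n < i+1 →
        sumOver (boundedPartitions b n) f ≡ sumOver (boundedPartitions (b [ c ]≔ i) n) f
      boundedPartitions-small {n} f n<i+1 = sumOver-unique f
        (boundedPartitions-unique b n) (boundedPartitions-unique (b [ c ]≔ i) n) (mk⇔ to from)
        where
        to : ∀ {π} → π ∈ boundedPartitions b n → π ∈ boundedPartitions (b [ c ]≔ i) n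
        to π∈ with Equivalence.to (∈-boundedPartitions b n) π∈
        ... | (qs , sz) , ps with bounded-split c b eq qs ps
        ... | inj₁ ps′ = Equivalence.from (∈-boundedPartitions (b [ c ]≔ i) n) ((qs , sz) , ps′)
        ... | inj₂ (π′ , refl , _) = contradiction
          (ℕ.m+n≤o⇒m≤o i+1 (ℕ.≤-reflexive (trans (sym (size-addPart c i+1 π′)) sz)))
          (ℕ.<⇒≱ n<i+1)

        from : ∀ {π} → π ∈ boundedPartitions (b [ c ]≔ i) n → π ∈ boundedPartitions b n
        from π∈ =
          let qs , ps = Equivalence.to (∈-boundedPartitions (b [ c ]≔ i) n) π∈
          in Equivalence.from (∈-boundedPartitions b n) (qs , boundedBy-suc c b eq ps)

  -- Pascal's rule and the difference equation of the weights

  binomial-pascal : ∀ x r → binomial (1ℤ ℤ.+ x) (suc r) ≡ binomial x (suc r) ℤ.+ binomial x r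
  binomial-pascal x r = ℤ.*-cancelʳ-≡ _ _ (ℤ.+ (suc r !)) {{suc r ℕ.!≢0}} (begin
    binomial (1ℤ ℤ.+ x) (suc r) ℤ.* ℤ.+ (suc r !)
      ≡⟨ binomial-exact (1ℤ ℤ.+ x) (suc r) ⟩
    fallingFactorial (1ℤ ℤ.+ x) (suc r)
      ≡⟨ fallingFactorial-pascal x r ⟩
    fallingFactorial x (suc r) ℤ.+ ℤ.+ suc r ℤ.* fallingFactorial x r
      ≡⟨ cong₂ (λ a b → a ℤ.+ ℤ.+ suc r ℤ.* b) (binomial-exact x (suc r)) (binomial-exact x r) ⟨
    binomial x (suc r) ℤ.* ℤ.+ (suc r !) ℤ.+ ℤ.+ suc r ℤ.* (binomial x r ℤ.* ℤ.+ (r !))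
      ≡⟨ factor (binomial x (suc r)) (ℤ.+ (suc r !)) (ℤ.+ suc r) (binomial x r) (ℤ.+ (r !)) ⟩
    binomial x (suc r) ℤ.* ℤ.+ (suc r !) ℤ.+ binomial x r ℤ.* (ℤ.+ suc r ℤ.* ℤ.+ (r !))
      ≡⟨ cong (λ a → binomial x (suc r) ℤ.* ℤ.+ (suc r !) ℤ.+ binomial x r ℤ.* a) (ℤ.pos-* (suc r) (r !)) ⟨
    binomial x (suc r) ℤ.* ℤ.+ (suc r !) ℤ.+ binomial x r ℤ.* ℤ.+ (suc r !)
      ≡⟨ ℤ.*-distribʳ-+ (ℤ.+ (suc r !)) (binomial x (suc r)) (binomial x r) ⟨
    (binomial x (suc r) ℤ.+ binomial x r) ℤ.* ℤ.+ (suc r !) ∎)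
    where
    factor : ∀ a f s b g → a ℤ.* f ℤ.+ s ℤ.* (b ℤ.* g) ≡ a ℤ.* f ℤ.+ b ℤ.* (s ℤ.* g)
    factor = solve-∀

  binomial-small : ∀ {n r} → n < r → binomial (ℤ.+ n) r ≡ 0ℤ
  binomial-small {zero}  {suc r} _       = ℤ.*-cancelʳ-≡ _ _ (ℤ.+ (suc r !)) {{suc r ℕ.!≢0}}
    -- At x = -1 the factor 1 + x split off by `fallingFactorial-suc` is 0.
    (trans (binomial-exact 0ℤ (suc r)) (fallingFactorial-suc -1ℤ r))
  binomial-small {suc n} {suc r} (s≤s h) =
    trans (binomial-pascal (ℤ.+ n) r)
      (cong₂ ℤ._+_ (binomial-small (ℕ.m≤n⇒m≤1+n h)) (binomial-small h))

  weight : ℕ → ℤ → ℤ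
  weight j m = binomial (m ℤ.+ ℤ.+ j ℤ.- 1ℤ) (2 ℕ.* j) ℤ.* -1ℤ ℤ.^ ∣ m ∣

  sign-suc : ∀ m → -1ℤ ℤ.^ ∣ 1ℤ ℤ.+ m ∣ ≡ ℤ.- (-1ℤ ℤ.^ ∣ m ∣)
  sign-suc (ℤ.+ n)      = ℤ.-1*i≡-i _
  sign-suc -[1+ zero ]  = refl
  sign-suc -[1+ suc n ] = sym (trans (cong ℤ.-_ (ℤ.-1*i≡-i _)) (ℤ.neg-involutive _))

  sign-pred : ∀ m → -1ℤ ℤ.^ ∣ m ℤ.- 1ℤ ∣ ≡ ℤ.- (-1ℤ ℤ.^ ∣ m ∣)
  sign-pred m = begin
    s                             ≡⟨ ℤ.neg-involutive s ⟨
    ℤ.- (ℤ.- s)                   ≡⟨ cong ℤ.-_ (sign-suc (m ℤ.- 1ℤ)) ⟨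
    ℤ.- (-1ℤ ℤ.^ ∣ 1ℤ ℤ.+ (m ℤ.- 1ℤ) ∣) ≡⟨ cong (λ a → ℤ.- (-1ℤ ℤ.^ ∣ a ∣)) (cancel m) ⟩
    ℤ.- (-1ℤ ℤ.^ ∣ m ∣)           ∎
    where
    s = -1ℤ ℤ.^ ∣ m ℤ.- 1ℤ ∣
    cancel : ∀ m → 1ℤ ℤ.+ (m ℤ.- 1ℤ) ≡ m
    cancel = solve-∀

  -- The difference equation of `weight-suc` one index lower, with 0 in place of a weight of index
  -- -1.
  weight-0 : ∀ m → weight 0 (1ℤ ℤ.+ m) ℤ.+ weight 0 (m ℤ.- 1ℤ) ≡ ℤ.- (weight 0 m ℤ.+ weight 0 m)
  weight-0 m = trans (cong₂ (λ a b → 1ℤ ℤ.* a ℤ.+ 1ℤ ℤ.* b) (sign-suc m) (sign-pred m)) (lemma (-1ℤ ℤ.^ ∣ m ∣))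
    where
    lemma : ∀ s → 1ℤ ℤ.* (ℤ.- s) ℤ.+ 1ℤ ℤ.* (ℤ.- s) ≡ ℤ.- (1ℤ ℤ.* s ℤ.+ 1ℤ ℤ.* s)
    lemma = solve-∀

  -- The second central difference of m ↦ binomial (m + j) (2j + 2) is
  -- m ↦ binomial (m + j - 1) (2j).
  weight-suc : ∀ j m → weight (suc j) (1ℤ ℤ.+ m) ℤ.+ weight (suc j) (m ℤ.- 1ℤ) ≡
                       ℤ.- (weight (suc j) m ℤ.+ weight (suc j) m ℤ.+ weight j m)
  weight-suc j m = begin
    binomial (1ℤ ℤ.+ m ℤ.+ ℤ.+ suc j ℤ.- 1ℤ) 2j+2 ℤ.* -1ℤ ℤ.^ ∣ 1ℤ ℤ.+ m ∣ ℤ.+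
      binomial (m ℤ.- 1ℤ ℤ.+ ℤ.+ suc j ℤ.- 1ℤ) 2j+2 ℤ.* -1ℤ ℤ.^ ∣ m ℤ.- 1ℤ ∣
      ≡⟨ cong₂ ℤ._+_
           (cong₂ ℤ._*_ (cong₂ binomial (e₂ m (ℤ.+ j)) r) (sign-suc m))
           (cong₂ ℤ._*_ (cong₂ binomial (e₀ m (ℤ.+ j)) r) (sign-pred m)) ⟩
    binomial (1ℤ ℤ.+ (1ℤ ℤ.+ y)) (suc (suc 2j)) ℤ.* (ℤ.- s) ℤ.+ binomial y (suc (suc 2j)) ℤ.* (ℤ.- s)
      ≡⟨ cong (λ a → a ℤ.* (ℤ.- s) ℤ.+ b₂ ℤ.* (ℤ.- s))
           (trans (binomial-pascal (1ℤ ℤ.+ y) (suc 2j))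
                  (cong₂ ℤ._+_ (binomial-pascal y (suc 2j)) (binomial-pascal y 2j))) ⟩
    (b₂ ℤ.+ b₁ ℤ.+ (b₁ ℤ.+ b₀)) ℤ.* (ℤ.- s) ℤ.+ b₂ ℤ.* (ℤ.- s)
      ≡⟨ lemma b₂ b₁ b₀ s ⟩
    ℤ.- ((b₂ ℤ.+ b₁) ℤ.* s ℤ.+ (b₂ ℤ.+ b₁) ℤ.* s ℤ.+ b₀ ℤ.* s)
      ≡⟨ cong (λ a → ℤ.- (a ℤ.* s ℤ.+ a ℤ.* s ℤ.+ b₀ ℤ.* s))
           (trans (cong₂ binomial (e₁ m (ℤ.+ j)) r) (binomial-pascal y (suc 2j))) ⟨
    ℤ.- (weight (suc j) m ℤ.+ weight (suc j) m ℤ.+ weight j m) ∎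
    where
    2j   = 2 ℕ.* j
    2j+2 = 2 ℕ.* suc j
    y    = m ℤ.+ ℤ.+ j ℤ.- 1ℤ
    s    = -1ℤ ℤ.^ ∣ m ∣
    b₂   = binomial y (suc (suc 2j))
    b₁   = binomial y (suc 2j)
    b₀   = binomial y 2j
    r : 2j+2 ≡ suc (suc 2j)
    r = ℕ.*-suc 2 j
    e₂ : ∀ m j → 1ℤ ℤ.+ m ℤ.+ (1ℤ ℤ.+ j) ℤ.- 1ℤ ≡ 1ℤ ℤ.+ (1ℤ ℤ.+ (m ℤ.+ j ℤ.- 1ℤ))
    e₂ = solve-∀
    e₁ : ∀ m j → m ℤ.+ (1ℤ ℤ.+ j) ℤ.- 1ℤ ≡ 1ℤ ℤ.+ (m ℤ.+ j ℤ.- 1ℤ)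
    e₁ = solve-∀
    e₀ : ∀ m j → m ℤ.- 1ℤ ℤ.+ (1ℤ ℤ.+ j) ℤ.- 1ℤ ≡ m ℤ.+ j ℤ.- 1ℤ
    e₀ = solve-∀
    lemma : ∀ b₂ b₁ b₀ s → (b₂ ℤ.+ b₁ ℤ.+ (b₁ ℤ.+ b₀)) ℤ.* (ℤ.- s) ℤ.+ b₂ ℤ.* (ℤ.- s) ≡
            ℤ.- ((b₂ ℤ.+ b₁) ℤ.* s ℤ.+ (b₂ ℤ.+ b₁) ℤ.* s ℤ.+ b₀ ℤ.* s)
    lemma = solve-∀

  -- The binomial has upper argument j, below its lower one 2j + 2. With no parts at all, F
  -- therefore has only its x^0 term.
  weight-at-0 : ∀ j → weight (suc j) 0ℤ ≡ 0ℤ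
  weight-at-0 j = trans (ℤ.*-identityʳ _)
    (trans (cong (λ a → binomial a (2 ℕ.* suc j)) (ℤ.+-identityˡ (ℤ.+ j)))
           (binomial-small (ℕ.s≤s (ℕ.m≤m+n j _))))

  -- Moments as sums over all colored partitions

  indicator : ∀ {P : Set} → Dec P → ℤ
  indicator (yes _) = 1ℤ
  indicator (no  _) = 0ℤ

  sumOver-zero : ∀ {A : Set} (xs : List A) {f : A → ℤ} → All (λ x → f x ≡ 0ℤ) xs → sumOver xs f ≡ 0ℤ
  sumOver-zero []       []       = refl
  sumOver-zero (x ∷ xs) (p ∷ ps) = cong₂ ℤ._+_ p (sumOver-zero xs ps)

  sumOver-+ : ∀ {A : Set} (xs : List A) (f g : A → ℤ) →
              sumOver xs (λ x → f x ℤ.+ g x) ≡ sumOver xs f ℤ.+ sumOver xs g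
  sumOver-+ []       f g = refl
  sumOver-+ (x ∷ xs) f g = trans (cong (ℤ._+_ (f x ℤ.+ g x)) (sumOver-+ xs f g)) (lemma (f x) (g x) _ _)
    where
    lemma : ∀ a b c d → a ℤ.+ b ℤ.+ (c ℤ.+ d) ≡ a ℤ.+ c ℤ.+ (b ℤ.+ d)
    lemma = solve-∀

  sumOver-neg : ∀ {A : Set} (xs : List A) (f : A → ℤ) → sumOver xs (λ x → ℤ.- f x) ≡ ℤ.- sumOver xs f
  sumOver-neg []       f = refl
  sumOver-neg (x ∷ xs) f =
    trans (cong (ℤ._+_ (ℤ.- f x)) (sumOver-neg xs f)) (sym (ℤ.neg-distrib-+ (f x) _))

  sumOver-indicator : ∀ (h : ℤ → ℤ) {c ms} → Unique ms → c ∈ ms →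
                      sumOver ms (λ m → h m ℤ.* indicator (c ℤ.≟ m)) ≡ h c
  sumOver-indicator h {c} {m ∷ ms} (m∉ ∷ ms!) c∈ with c ℤ.≟ m | c∈
  ... | yes refl | _ = begin
    h c ℤ.* 1ℤ ℤ.+ sumOver ms (λ m → h m ℤ.* indicator (c ℤ.≟ m))
      ≡⟨ cong₂ ℤ._+_ (ℤ.*-identityʳ (h c)) (sumOver-zero ms (All.map vanish m∉)) ⟩
    h c ℤ.+ 0ℤ ≡⟨ ℤ.+-identityʳ (h c) ⟩
    h c        ∎
    where
    vanish : ∀ {m} → c ≢ m → h m ℤ.* indicator (c ℤ.≟ m) ≡ 0ℤ
    vanish {m} c≢m with c ℤ.≟ m
    ... | yes c≡m = contradiction c≡m c≢m
    ... | no  _   = ℤ.*-zeroʳ (h m)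
  ... | no c≢m | here c≡m = contradiction c≡m c≢m
  ... | no _   | there c∈′ = trans
    (cong₂ ℤ._+_ (ℤ.*-zeroʳ (h m)) (sumOver-indicator h ms! c∈′)) (ℤ.+-identityˡ (h c))

  -- Grouping by the value of `c`: as `ms` contains `c x` exactly once, each `x` contributes
  -- `h (c x)` once.
  sumOver-fibres : ∀ {A : Set} (c : A → ℤ) (h : ℤ → ℤ) {ms} → Unique ms →
    ∀ xs → All (λ x → c x ∈ ms) xs →
    sumOver ms (λ m → h m ℤ.* ℤ.+ length (filter (λ x → c x ℤ.≟ m) xs)) ≡ sumOver xs (h ∘ c)
  sumOver-fibres c h {ms} ms! []       []       =
    sumOver-zero ms (All.tabulate (λ {m} _ → ℤ.*-zeroʳ (h m)))
  sumOver-fibres c h {ms} ms! (x ∷ xs) (p ∷ ps) = begin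
    sumOver ms (λ m → h m ℤ.* ℤ.+ length (filter (λ x → c x ℤ.≟ m) (x ∷ xs)))
      ≡⟨ sumOver-cong ms split ⟩
    sumOver ms (λ m → h m ℤ.* indicator (c x ℤ.≟ m) ℤ.+ h m ℤ.* count m)
      ≡⟨ sumOver-+ ms _ _ ⟩
    sumOver ms (λ m → h m ℤ.* indicator (c x ℤ.≟ m)) ℤ.+ sumOver ms (λ m → h m ℤ.* count m)
      ≡⟨ cong₂ ℤ._+_ (sumOver-indicator h ms! p) (sumOver-fibres c h ms! xs ps) ⟩
    h (c x) ℤ.+ sumOver xs (h ∘ c) ∎
    where
    count : ℤ → ℤ
    count m = ℤ.+ length (filter (λ x → c x ℤ.≟ m) xs)
    split : ∀ m → h m ℤ.* ℤ.+ length (filter (λ x → c x ℤ.≟ m) (x ∷ xs)) ≡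
                  h m ℤ.* indicator (c x ℤ.≟ m) ℤ.+ h m ℤ.* count m
    split m with c x ℤ.≟ m
    ... | yes _ = ℤ.*-distribˡ-+ (h m) 1ℤ (count m)
    ... | no  _ = sym (trans (cong (ℤ._+ h m ℤ.* count m) (ℤ.*-zeroʳ (h m))) (ℤ.+-identityˡ _))

  range-unique : ∀ n → Unique (range n)
  range-unique n = Unique.map⁺ (λ {i} {j} eq → ℤ.+-injective (∙-cancelʳ (ℤ.- ℤ.+ n) (ℤ.+ i) (ℤ.+ j) eq))
                               (Unique.upTo⁺ (suc (2 ℕ.* n)))
    where open import Algebra.Properties.AbelianGroup ℤ.+-0-abelianGroup using (∙-cancelʳ)

  ∈-range : ∀ {a b n} → a ≤ n → b ≤ n → ℤ.+ a ℤ.- ℤ.+ b ∈ range n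
  ∈-range {a} {b} {n} a≤n b≤n = subst (_∈ range n) eq
    -- The position of a - b in `range n` is a - b + n, that is a + (n ∸ b).
    (∈.∈-map⁺ (λ i → ℤ.+ i ℤ.- ℤ.+ n) (∈.∈-upTo⁺ (s≤s bound)))
    where
    bound : a ℕ.+ (n ℕ.∸ b) ≤ 2 ℕ.* n
    bound = ℕ.+-mono-≤ a≤n (ℕ.≤-trans (ℕ.m∸n≤m n b) (ℕ.m≤m+n n 0))
    lemma : ∀ a d b → a ℤ.+ d ℤ.- (b ℤ.+ d) ≡ a ℤ.- b
    lemma = solve-∀
    eq : ℤ.+ (a ℕ.+ (n ℕ.∸ b)) ℤ.- ℤ.+ n ≡ ℤ.+ a ℤ.- ℤ.+ b
    eq = trans (cong (λ m → ℤ.+ a ℤ.+ ℤ.+ (n ℕ.∸ b) ℤ.- ℤ.+ m) (sym (ℕ.m+[n∸m]≡n b≤n)))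
               (lemma (ℤ.+ a) (ℤ.+ (n ℕ.∸ b)) (ℤ.+ b))

  crank∈range : ∀ {k n} {π : Vec (List ℕ) (2 ℕ.+ k)} → IsColoredPartition (2 ℕ.+ k) n π → crank π ∈ range n
  crank∈range {n = n} {π₁ ∷ π₂ ∷ π} ((p₁ , _) VecAll.∷ (p₂ , _) VecAll.∷ _ , sz) =
    ∈-range (ℕ.≤-trans (length≤sum p₁) (ℕ.m+n≤o⇒m≤o (ℕ.sum π₁) h))
            (ℕ.≤-trans (length≤sum p₂) (ℕ.m+n≤o⇒m≤o (ℕ.sum π₂) (ℕ.m+n≤o⇒n≤o (ℕ.sum π₁) h)))
    where h = ℕ.≤-reflexive sz

  μ-as-sum : ∀ j k n → μ j (2 ℕ.+ k) n ≡ sumOver (coloredPartitions (2 ℕ.+ k) n) (weight j ∘ crank)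
  μ-as-sum j k n = sumOver-fibres crank (weight j) (range-unique n) (coloredPartitions (2 ℕ.+ k) n)
    (All.tabulate (λ π∈ → crank∈range (Equivalence.to (∈-coloredPartitions (2 ℕ.+ k) n) π∈)))

-- Generating series of the moments

module ℤ[[q]] = PowerSeries ℤ.+-*-commutativeRing
ℤ[[q]]-ring : CommutativeRing _ _
ℤ[[q]]-ring = ℤ[[q]].seriesRing
module ℤ[[q]][[x]] = PowerSeries ℤ[[q]]-ring

[-q]^ : ℕ → ℤ[[q]].Series
[-q]^ i n = -1ℤ ℤ.^ i ℤ.* ℤ[[q]].X^ i n

[-q]^-⊛ : ∀ i a n → ([-q]^ i ℤ[[q]].⊛ a) n ≡ -1ℤ ℤ.^ i ℤ.* ℤ[[q]].shift i a n
[-q]^-⊛ i a n = ≡.trans (ℤ[[q]].·-⊛ (-1ℤ ℤ.^ i) (ℤ[[q]].X^ i) a n)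
                        (≡.cong (-1ℤ ℤ.^ i ℤ.*_) (ℤ[[q]].X^-⊛ i a n))

-- The sign substitutes -q for q, so that a part i counts as (-q)^i.
crankSum : ∀ {k} → Vec ℕ (2 ℕ.+ k) → (ℤ → ℤ) → ℤ[[q]].Series
crankSum b ψ n = -1ℤ ℤ.^ n ℤ.* sumOver (boundedPartitions b n) (ψ ∘ crank)

module A = CommutativeRing ℤ[[q]][[x]].seriesRing

module _ where

  open CommutativeRing ℤ[[q]]-ring hiding (zero)
  open import Algebra.Properties.Semiring.Mult semiring using () renaming (_×_ to _·_)
  open ℤ[[q]] using (_≈[_]_; shift)
  open ℤ[[q]][[x]] using (_≋_; _⊛_; θ; const)

  -- `boundedPartitions-split` for generating series; `ψ′` is `ψ` corrected for the change of the
  -- crank by the added part.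
  crankSum-split : ∀ {k i} (c : Fin (2 ℕ.+ k)) (b : Vec ℕ (2 ℕ.+ k)) {ψ ψ′ : ℤ → ℤ} →
    lookup b c ≡ suc i → (∀ π → ψ (crank (addPart c (suc i) π)) ≡ ψ′ (crank π)) →
    crankSum b ψ ≈ crankSum (b [ c ]≔ i) ψ + [-q]^ (suc i) * crankSum b ψ′
  crankSum-split {i = i} c b {ψ} {ψ′} eq add n with n ℕ.<? suc i
  ... | yes n<i+1 = begin
    s ℤ.* sumOver (boundedPartitions b n) (ψ ∘ crank)
      ≡⟨ ≡.cong (s ℤ.*_) (boundedPartitions-small c b eq (ψ ∘ crank) n<i+1) ⟩
    crankSum (b [ c ]≔ i) ψ n
      ≡⟨ ℤ.+-identityʳ _ ⟨
    crankSum (b [ c ]≔ i) ψ n ℤ.+ 0ℤ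
      ≡⟨ ≡.cong (ℤ._+_ (crankSum (b [ c ]≔ i) ψ n)) (≡.trans ([-q]^-⊛ (suc i) _ n)
           (≡.trans (≡.cong (-1ℤ ℤ.^ suc i ℤ.*_) (ℤ[[q]].shift-< (crankSum b ψ′) n<i+1))
                    (ℤ.*-zeroʳ (-1ℤ ℤ.^ suc i)))) ⟨
    crankSum (b [ c ]≔ i) ψ n ℤ.+ ([-q]^ (suc i) * crankSum b ψ′) n ∎
    where
    open ≡.≡-Reasoning
    s = -1ℤ ℤ.^ n
  ... | no n≮i+1 with ℕ.m≤n⇒∃[o]m+o≡n (ℕ.≮⇒≥ n≮i+1)
  ...   | m , ≡.refl = begin
    s ℤ.* sumOver (boundedPartitions b n) (ψ ∘ crank)
      ≡⟨ ≡.cong (s ℤ.*_) (boundedPartitions-split c b eq m (ψ ∘ crank)) ⟩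
    s ℤ.* (u ℤ.+ sumOver (boundedPartitions b m) (ψ ∘ crank ∘ addPart c (suc i)))
      ≡⟨ ≡.cong (λ a → s ℤ.* (u ℤ.+ a)) (sumOver-cong (boundedPartitions b m) add) ⟩
    s ℤ.* (u ℤ.+ v)
      ≡⟨ ℤ.*-distribˡ-+ s u v ⟩
    s ℤ.* u ℤ.+ s ℤ.* v
      ≡⟨ ≡.cong (λ a → s ℤ.* u ℤ.+ a ℤ.* v) (ℤ.^-distribˡ-+-* -1ℤ (suc i) m) ⟩
    s ℤ.* u ℤ.+ -1ℤ ℤ.^ suc i ℤ.* -1ℤ ℤ.^ m ℤ.* v
      ≡⟨ ≡.cong (ℤ._+_ (s ℤ.* u)) (ℤ.*-assoc (-1ℤ ℤ.^ suc i) (-1ℤ ℤ.^ m) v) ⟩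
    s ℤ.* u ℤ.+ -1ℤ ℤ.^ suc i ℤ.* crankSum b ψ′ m
      ≡⟨ ≡.cong (λ a → s ℤ.* u ℤ.+ -1ℤ ℤ.^ suc i ℤ.* a) (ℤ[[q]].shift-+ (suc i) (crankSum b ψ′) m) ⟨
    s ℤ.* u ℤ.+ -1ℤ ℤ.^ suc i ℤ.* shift (suc i) (crankSum b ψ′) n
      ≡⟨ ≡.cong (ℤ._+_ (s ℤ.* u)) ([-q]^-⊛ (suc i) (crankSum b ψ′) n) ⟨
    crankSum (b [ c ]≔ i) ψ n ℤ.+ ([-q]^ (suc i) * crankSum b ψ′) n ∎
    where
    open ≡.≡-Reasoning
    s = -1ℤ ℤ.^ n
    u = sumOver (boundedPartitions (b [ c ]≔ i) n) (ψ ∘ crank)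
    v = sumOver (boundedPartitions b m) (ψ′ ∘ crank)

  module _ {c ℓ} (R : CommutativeRing c ℓ) where
    private module R = CommutativeRing R
    open import Relation.Binary.Reasoning.Setoid R.setoid
    open import Algebra.Solver.Ring.NaturalCoefficients.Default R.commutativeSemiring
      using (solve; _:+_; _:*_; _:=_; con)

    -- Here t, u and a stand for crank sums with the bound lowered in both, one or none of the first
    -- two colors, and subscripts for a shift of the crank. By the first three equations t = a - x
    -- (a₊ + a₋) + x² a, and the fourth replaces a₊ + a₋.
    eliminate-shifted : ∀ x t u u₋ a a₊ a₋ a′ →
      a R.≈ u R.+ x R.* a₊ → a₋ R.≈ u₋ R.+ x R.* a → u R.≈ t R.+ x R.* u₋ →
      a₊ R.+ a₋ R.+ (a R.+ a R.+ a′) R.≈ R.0# →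
      t R.≈ (R.1# R.+ x) R.* (R.1# R.+ x) R.* a R.+ x R.* a′
    eliminate-shifted x t u u₋ a a₊ a₋ a′ p q r d = begin
      t
        -- Adding x times the vanishing sum keeps the computation free of subtraction.
        ≈⟨ R.trans (R.+-congˡ (R.zeroʳ x)) (R.+-identityʳ t) ⟨
      t R.+ x R.* R.0#
        ≈⟨ R.+-congˡ (R.*-congˡ d) ⟨
      t R.+ x R.* (a₊ R.+ a₋ R.+ (a R.+ a R.+ a′))
        ≈⟨ R.+-congˡ (R.*-congˡ (R.+-congʳ (R.+-congˡ q))) ⟩
      t R.+ x R.* (a₊ R.+ (u₋ R.+ x R.* a) R.+ (a R.+ a R.+ a′))
        ≈⟨ solve 6 (λ x t u₋ a a₊ a′ → t :+ x :* (a₊ :+ (u₋ :+ x :* a) :+ (a :+ a :+ a′)) :=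
             t :+ x :* u₋ :+ x :* a₊ :+ x :* (x :* a :+ a :+ a :+ a′)) R.refl x t u₋ a a₊ a′ ⟩
      t R.+ x R.* u₋ R.+ x R.* a₊ R.+ x R.* (x R.* a R.+ a R.+ a R.+ a′)
        ≈⟨ R.+-congʳ (R.trans p (R.+-congʳ r)) ⟨
      a R.+ x R.* (x R.* a R.+ a R.+ a R.+ a′)
        ≈⟨ solve 3 (λ x a a′ → a :+ x :* (x :* a :+ a :+ a :+ a′) :=
             (con 1 :+ x) :* (con 1 :+ x) :* a :+ x :* a′) R.refl x a a′ ⟩
      (R.1# R.+ x) R.* (R.1# R.+ x) R.* a R.+ x R.* a′ ∎

    subtract-multiple : ∀ x u a → a R.≈ u R.+ x R.* a → u R.≈ (R.1# R.- x) R.* a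
    subtract-multiple x u a p = begin
      u                                         ≈⟨ R.+-identityʳ u ⟨
      u R.+ R.0#                                ≈⟨ R.+-congˡ (R.-‿inverseʳ (x R.* a)) ⟨
      u R.+ (x R.* a R.- x R.* a)               ≈⟨ R.+-assoc u (x R.* a) (R.- (x R.* a)) ⟨
      u R.+ x R.* a R.- x R.* a                 ≈⟨ R.+-congʳ p ⟨
      a R.- x R.* a                             ≈⟨ R.+-cong (R.*-identityˡ a) (R.sym (-‿distribˡ-* x a)) ⟨
      R.1# R.* a R.+ R.- x R.* a                ≈⟨ R.distribʳ a R.1# (R.- x) ⟨
      (R.1# R.- x) R.* a                        ∎
      where open import Algebra.Properties.Ring R.ring using (-‿distribˡ-*)

  crankSum-neg : ∀ {k} (b : Vec ℕ (2 ℕ.+ k)) (f g h h′ : ℤ → ℤ) →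
    (∀ m → f m ℤ.+ g m ≡ ℤ.- (h m ℤ.+ h m ℤ.+ h′ m)) →
    crankSum b f + crankSum b g + (crankSum b h + crankSum b h + crankSum b h′) ≈ 0#
  crankSum-neg b f g h h′ eq n = begin
    s ℤ.* Σ f ℤ.+ s ℤ.* Σ g ℤ.+ (s ℤ.* Σ h ℤ.+ s ℤ.* Σ h ℤ.+ s ℤ.* Σ h′)
      ≡⟨ factor s (Σ f) (Σ g) (Σ h) (Σ h′) ⟩
    s ℤ.* (Σ f ℤ.+ Σ g ℤ.+ (Σ h ℤ.+ Σ h ℤ.+ Σ h′))
      ≡⟨ ≡.cong (λ a → s ℤ.* (a ℤ.+ (Σ h ℤ.+ Σ h ℤ.+ Σ h′))) relation ⟩
    s ℤ.* (ℤ.- (Σ h ℤ.+ Σ h ℤ.+ Σ h′) ℤ.+ (Σ h ℤ.+ Σ h ℤ.+ Σ h′))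
      ≡⟨ cancel s (Σ h ℤ.+ Σ h ℤ.+ Σ h′) ⟩
    0ℤ ∎
    where
    open ≡.≡-Reasoning
    s = -1ℤ ℤ.^ n
    xs = boundedPartitions b n
    Σ : (ℤ → ℤ) → ℤ
    Σ ψ = sumOver xs (ψ ∘ crank)
    relation : Σ f ℤ.+ Σ g ≡ ℤ.- (Σ h ℤ.+ Σ h ℤ.+ Σ h′)
    relation = begin
      Σ f ℤ.+ Σ g
        ≡⟨ sumOver-+ xs (f ∘ crank) (g ∘ crank) ⟨
      Σ (λ m → f m ℤ.+ g m)
        ≡⟨ sumOver-cong xs (eq ∘ crank) ⟩
      Σ (λ m → ℤ.- (h m ℤ.+ h m ℤ.+ h′ m))
        ≡⟨ sumOver-neg xs (λ π → h (crank π) ℤ.+ h (crank π) ℤ.+ h′ (crank π)) ⟩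
      ℤ.- Σ (λ m → h m ℤ.+ h m ℤ.+ h′ m)
        ≡⟨ ≡.cong ℤ.-_ (≡.trans (sumOver-+ xs (λ π → h (crank π) ℤ.+ h (crank π)) (h′ ∘ crank))
             (≡.cong (ℤ._+ Σ h′) (sumOver-+ xs (h ∘ crank) (h ∘ crank)))) ⟩
      ℤ.- (Σ h ℤ.+ Σ h ℤ.+ Σ h′) ∎
    factor : ∀ s a b c d → s ℤ.* a ℤ.+ s ℤ.* b ℤ.+ (s ℤ.* c ℤ.+ s ℤ.* c ℤ.+ s ℤ.* d) ≡
                           s ℤ.* (a ℤ.+ b ℤ.+ (c ℤ.+ c ℤ.+ d))
    factor = solve-∀
    cancel : ∀ s a → s ℤ.* (ℤ.- a ℤ.+ a) ≡ 0ℤ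
    cancel = solve-∀

  module _ {k} (i : ℕ) (r : Vec ℕ k) where

    private
      x : ℤ[[q]].Series
      x = [-q]^ (suc i)
      b b′ : Vec ℕ (2 ℕ.+ k)
      b  = suc i ∷ suc i ∷ r
      b′ = i ∷ suc i ∷ r

    -- A part of color one raises the crank and a part of color two lowers it. Two splits on color
    -- one, with weights `ψ` and `ψ₋`, and one on color two, with weight `ψ`, form a system that the
    -- difference equation closes.
    crankSum-step : ∀ (ψ ψ′ : ℤ → ℤ) →
      (∀ m → ψ (1ℤ ℤ.+ m) ℤ.+ ψ (m ℤ.- 1ℤ) ≡ ℤ.- (ψ m ℤ.+ ψ m ℤ.+ ψ′ m)) →
      crankSum (i ∷ i ∷ r) ψ ≈ (1# + x) * (1# + x) * crankSum b ψ + x * crankSum b ψ′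
    crankSum-step ψ ψ′ eq = eliminate-shifted ℤ[[q]]-ring x (crankSum (i ∷ i ∷ r) ψ)
      (crankSum b′ ψ) (crankSum b′ ψ₋) (crankSum b ψ) (crankSum b ψ₊) (crankSum b ψ₋) (crankSum b ψ′)
      (crankSum-split zero b {ψ} {ψ₊} ≡.refl
        (λ { (π₁ ∷ π₂ ∷ _) → ≡.cong ψ (ℤ.+-assoc 1ℤ (ℤ.+ length π₁) (ℤ.- (ℤ.+ length π₂))) }))
      (crankSum-split zero b {ψ₋} {ψ} ≡.refl
        (λ { (π₁ ∷ π₂ ∷ _) → ≡.cong ψ (cancel (ℤ.+ length π₁) (ℤ.+ length π₂)) }))
      (crankSum-split (suc zero) b′ {ψ} {ψ₋} ≡.refl
        (λ { (π₁ ∷ π₂ ∷ _) → ≡.cong ψ (sub-suc (ℤ.+ length π₁) (ℤ.+ length π₂)) }))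
      (crankSum-neg b ψ₊ ψ₋ ψ ψ′ eq)
      where
      ψ₊ ψ₋ : ℤ → ℤ
      ψ₊ m = ψ (1ℤ ℤ.+ m)
      ψ₋ m = ψ (m ℤ.- 1ℤ)
      cancel : ∀ a b → 1ℤ ℤ.+ a ℤ.- b ℤ.- 1ℤ ≡ a ℤ.- b
      cancel = solve-∀
      sub-suc : ∀ a b → a ℤ.- (1ℤ ℤ.+ b) ≡ a ℤ.- b ℤ.- 1ℤ
      sub-suc = solve-∀

  -- The series F for bounded parts, defined by its coefficients in x; its product formula is the
  -- recursion `momentSeries-step`.
  momentSeries : ∀ {k} → Vec ℕ (2 ℕ.+ k) → ℤ[[q]][[x]].Series
  momentSeries b j = crankSum b (weight j)

  pairFactor : ℕ → ℤ[[q]][[x]].Series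
  pairFactor i = ℤ[[q]][[x]].linear ((1# + [-q]^ i) * (1# + [-q]^ i)) ([-q]^ i)

  momentSeries-step : ∀ {k} i (r : Vec ℕ k) →
    momentSeries (i ∷ i ∷ r) ≋
    pairFactor (suc i) ⊛ momentSeries (suc i ∷ suc i ∷ r)
  momentSeries-step i r zero    n = begin
    crankSum (i ∷ i ∷ r) (weight 0) n
      ≡⟨ crankSum-step i r (weight 0) (λ _ → 0ℤ)
           (λ m → ≡.trans (weight-0 m) (≡.cong ℤ.-_ (≡.sym (ℤ.+-identityʳ _)))) n ⟩
    (y * crankSum b (weight 0)) n ℤ.+ (x * crankSum b (λ _ → 0ℤ)) n
      ≡⟨ ≡.cong (ℤ._+_ ((y * crankSum b (weight 0)) n)) (≡.trans
           (*-congˡ {x} vanish n) (zeroʳ x n)) ⟩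
    (y * crankSum b (weight 0)) n ℤ.+ 0ℤ
      ≡⟨ ℤ.+-identityʳ _ ⟩
    (y * crankSum b (weight 0)) n ∎
    where
    open ≡.≡-Reasoning
    x = [-q]^ (suc i)
    y = (1# + x) * (1# + x)
    b : Vec ℕ _
    b = suc i ∷ suc i ∷ r
    vanish : crankSum b (λ _ → 0ℤ) ≈ 0#
    vanish n = ≡.trans
      (≡.cong (-1ℤ ℤ.^ n ℤ.*_) (sumOver-zero (boundedPartitions b n) (All.tabulate (λ _ → ≡.refl))))
      (ℤ.*-zeroʳ (-1ℤ ℤ.^ n))
  momentSeries-step i r (suc j) n = ≡.trans
    (crankSum-step i r (weight (suc j)) (weight j) (weight-suc j) n)
    (≡.sym (ℤ[[q]][[x]].linear-⊛-suc ((1# + [-q]^ (suc i)) * (1# + [-q]^ (suc i))) ([-q]^ (suc i))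
           (momentSeries (suc i ∷ suc i ∷ r)) j n))

  -- The third color does not enter the crank, so removing its part i + 1 leaves the weight alone
  -- and contributes a factor constant in x.
  momentSeries-step₃ : ∀ i →
    momentSeries (i ∷ i ∷ i ∷ []) ≋
    pairFactor (suc i) ⊛
      (const (1# - [-q]^ (suc i)) ⊛ momentSeries (suc i ∷ suc i ∷ suc i ∷ []))
  momentSeries-step₃ i j n = ≡.trans (momentSeries-step i (i ∷ []) j n)
    (ℤ[[q]][[x]].⊛-cong {a = pairFactor (suc i)} (λ _ _ → ≡.refl) third j n)
    where
    b : Vec ℕ 3
    b = suc i ∷ suc i ∷ suc i ∷ []
    x = [-q]^ (suc i)
    third : momentSeries (suc i ∷ suc i ∷ i ∷ []) ≋
            const (1# - x) ⊛ momentSeries b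
    third j n = ≡.trans
      (subtract-multiple ℤ[[q]]-ring x (crankSum (suc i ∷ suc i ∷ i ∷ []) (weight j)) (crankSum b (weight j))
        (crankSum-split (suc (suc zero)) b {weight j} {weight j} ≡.refl (λ { (_ ∷ _ ∷ _ ∷ []) → ≡.refl })) n)
      (≡.sym (ℤ[[q]][[x]].const-⊛ (1# - x) (momentSeries b) j n))

  -- Large bounds and the bound zero

  boundedBy-replicate : ∀ {k N} (π : Vec (List ℕ) k) → size π ≤ N → BoundedBy (replicate k N) π
  boundedBy-replicate []       _ = []
  boundedBy-replicate (π ∷ πs) h =
    parts≤ π (ℕ.m+n≤o⇒m≤o (ℕ.sum π) h) ∷ boundedBy-replicate πs (ℕ.m+n≤o⇒n≤o (ℕ.sum π) h)
    where
    parts≤ : ∀ {N} π → ℕ.sum π ≤ N → All (_≤ N) π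
    parts≤ []      _ = []
    parts≤ (p ∷ π) h = ℕ.m+n≤o⇒m≤o p h ∷ parts≤ π (ℕ.m+n≤o⇒n≤o p h)

  -- No part of a partition of n exceeds n, so the bound N excludes nothing.
  momentSeries-μ : ∀ k j {n N} → n ≤ N →
    momentSeries (replicate (2 ℕ.+ k) N) j n ≡ -1ℤ ℤ.^ n ℤ.* μ j (2 ℕ.+ k) n
  momentSeries-μ k j {n} {N} n≤N = ≡.cong (-1ℤ ℤ.^ n ℤ.*_) (≡.trans
    (≡.cong (λ xs → sumOver xs (weight j ∘ crank)) (List.filter-all (boundedBy? (replicate _ N))
      (All.tabulate (λ {π} π∈ → boundedBy-replicate π
        (ℕ.≤-trans (ℕ.≤-reflexive (proj₂ (Equivalence.to (∈-coloredPartitions (2 ℕ.+ k) n) π∈))) n≤N)))))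
    (≡.sym (μ-as-sum j k n)))

  boundedBy-0 : ∀ {k} (π : Vec (List ℕ) k) → BoundedBy (replicate k 0) π → size π ≡ 0
  boundedBy-0 []       _        = ≡.refl
  boundedBy-0 (π ∷ πs) (p ∷ ps) = ≡.cong₂ ℕ._+_ (sum≡0 p) (boundedBy-0 πs ps)
    where
    sum≡0 : ∀ {π} → All (_≤ 0) π → ℕ.sum π ≡ 0
    sum≡0 []         = ≡.refl
    sum≡0 (z≤n ∷ ps) = sum≡0 ps

  momentSeries-0-suc : ∀ {k} j n → momentSeries (replicate (2 ℕ.+ k) 0) j (suc n) ≡ 0ℤ
  momentSeries-0-suc {k} j n = ≡.trans
    (≡.cong (-1ℤ ℤ.^ suc n ℤ.*_) (sumOver-unique (weight j ∘ crank)
      (boundedPartitions-unique b (suc n)) [] (mk⇔ none (λ ()))))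
    (ℤ.*-zeroʳ (-1ℤ ℤ.^ suc n))
    where
    b = replicate (2 ℕ.+ k) 0
    none : ∀ {π} → π ∈ boundedPartitions b (suc n) → π ∈ []
    none {π} π∈ with Equivalence.to (∈-boundedPartitions b (suc n)) π∈
    ... | (_ , sz) , ps = contradiction (≡.trans (≡.sym sz) (boundedBy-0 π ps)) ℕ.1+n≢0

  -- Only the tuple of empty partitions is left. The hypothesis is its contribution, which is found
  -- by evaluating the enumeration for a concrete number of colors.
  momentSeries-0 : ∀ {k} → (∀ j → momentSeries (replicate (2 ℕ.+ k) 0) j 0 ≡ weight j 0ℤ) →
    momentSeries (replicate (2 ℕ.+ k) 0) ≋ const 1#
  momentSeries-0 p zero    zero    = p 0
  momentSeries-0 p (suc j) zero    = ≡.trans (p (suc j)) (weight-at-0 j)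
  momentSeries-0 {k} p zero (suc n)    = momentSeries-0-suc {k} 0 n
  momentSeries-0 {k} p (suc j) (suc n) = momentSeries-0-suc {k} (suc j) n

  -- The logarithmic derivative

  mutual
    -- c r m is the coefficient of x^r t^m in x t / ((1 - t)² - x t).
    c : ℕ → ℕ → ℕ
    c r zero    = 0
    c r (suc m) = c r m ℕ.+ Δc r m

    -- The forward difference of `c r`. Clearing the denominator in C = x t / ((1 - t)² - x t) shows
    -- that the second difference of `c (suc r)` is `c r`, and the initial value 1 is the numerator
    -- x t. Natural numbers as differences make `c r` increasing by construction. For r ≥ 1 it is
    -- the binomial coefficient of m + r - 1 over 2r - 1.
    Δc : ℕ → ℕ → ℕ
    Δc zero          m       = 0
    Δc (suc zero)    zero    = 1
    Δc (suc (suc r)) zero    = 0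
    Δc (suc r)       (suc m) = Δc (suc r) m ℕ.+ c r (suc m)

  c-zero : ∀ m → c 0 m ≡ 0
  c-zero zero    = ≡.refl
  c-zero (suc m) = ≡.cong (ℕ._+ 0) (c-zero m)

  c-mono : ∀ r {m n} → m ≤ n → c r m ≤ c r n
  c-mono r {m} m≤n with ℕ.m≤n⇒∃[o]m+o≡n m≤n
  ... | o , ≡.refl = go o
    where
    go : ∀ o → c r m ≤ c r (m ℕ.+ o)
    go zero    = ℕ.≤-reflexive (≡.cong (c r) (≡.sym (ℕ.+-identityʳ m)))
    go (suc o) = ℕ.≤-trans (go o) (ℕ.≤-trans (ℕ.m≤m+n _ _)
      (ℕ.≤-reflexive (≡.cong (c r) (≡.sym (ℕ.+-suc m o)))))

  -- The substitution t ↦ q^i.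
  expand : ℕ → (ℕ → ℤ) → ℕ → ℤ
  expand i u n with i ∣? n
  ... | yes (divides m _) = u m
  ... | no  _             = 0ℤ

  expand-* : ∀ i .{{_ : ℕ.NonZero i}} u m → expand i u (m ℕ.* i) ≡ u m
  expand-* i u m with i ∣? (m ℕ.* i)
  ... | yes (divides m′ eq) = ≡.cong u (≡.sym (ℕ.*-cancelʳ-≡ m m′ i eq))
  ... | no  ¬i∣n            = contradiction (divides-refl m) ¬i∣n

  expand-∤ : ∀ {i n} u → ¬ (i ∣ n) → expand i u n ≡ 0ℤ
  expand-∤ {i} {n} u ¬i∣n with i ∣? n
  ... | yes i∣n = contradiction i∣n ¬i∣n
  ... | no  _   = ≡.refl

  expand-cong : ∀ i {u v} → (∀ m → u m ≡ v m) → ∀ n → expand i u n ≡ expand i v n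
  expand-cong i eq n with i ∣? n
  ... | yes (divides m _) = eq m
  ... | no  _             = ≡.refl

  expand-+ : ∀ i u v n → expand i (λ m → u m ℤ.+ v m) n ≡ expand i u n ℤ.+ expand i v n
  expand-+ i u v n with i ∣? n
  ... | yes _ = ≡.refl
  ... | no  _ = ≡.refl

  expand-0 : ∀ i n → expand i (λ _ → 0ℤ) n ≡ 0ℤ
  expand-0 i n with i ∣? n
  ... | yes _ = ≡.refl
  ... | no  _ = ≡.refl

  expand-nonNeg : ∀ i {u} → (∀ m → 0ℤ ℤ.≤ u m) → ∀ n → 0ℤ ℤ.≤ expand i u n
  expand-nonNeg i u≥0 n with i ∣? n
  ... | yes (divides m _) = u≥0 m
  ... | no  _             = ℤ.≤-refl

  -- As m (2i) = (2m) i, the coefficient of index m on the left meets that of index 2m on the right;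
  -- at all other exponents the left side is 0.
  expand-≤ : ∀ i .{{_ : ℕ.NonZero i}} {u v} → (∀ m → 0ℤ ℤ.≤ u m) → (∀ m → v m ℤ.≤ u (m ℕ.* 2)) →
             ∀ n → expand (i ℕ.* 2) v n ℤ.≤ expand i u n
  expand-≤ i {u} {v} u≥0 v≤u n with i ℕ.* 2 ∣? n
  ... | yes (divides m ≡.refl) = ℤ.≤-trans (v≤u m) (ℤ.≤-reflexive (≡.sym
    (≡.trans (≡.cong (expand i u) (lemma m i)) (expand-* i u (m ℕ.* 2)))))
    where
    lemma : ∀ m i → m ℕ.* (i ℕ.* 2) ≡ m ℕ.* 2 ℕ.* i
    lemma m i = ≡.trans (≡.cong (m ℕ.*_) (ℕ.*-comm i 2)) (≡.sym (ℕ.*-assoc m 2 i))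
  ... | no  _                  = expand-nonNeg i u≥0 n

  shift-expand : ∀ i .{{_ : ℕ.NonZero i}} u n →
                 shift i (expand i u) n ≡ expand i (shift 1 u) n
  shift-expand i@(suc i′) u n with i ∣? n
  ... | yes (divides zero    ≡.refl) = ≡.refl
  ... | yes (divides (suc m) ≡.refl) = ≡.trans (ℤ[[q]].shift-+ i (expand i u) (m ℕ.* i)) (expand-* i u m)
  ... | no  ¬i∣n with n ℕ.<? i
  ...   | yes n<i = ℤ[[q]].shift-< (expand i u) n<i
  ...   | no  n≮i with ℕ.m≤n⇒∃[o]m+o≡n (ℕ.≮⇒≥ n≮i)
  ...     | o , ≡.refl = ≡.trans (ℤ[[q]].shift-+ i (expand i u) o)
    (expand-∤ {i} {o} u (λ { (divides m ≡.refl) → ¬i∣n (divides (suc m) ≡.refl) }))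

  expand-scale : ∀ i a u n → expand i (λ m → a ℤ.* u m) n ≡ a ℤ.* expand i u n
  expand-scale i a u n with i ∣? n
  ... | yes _ = ≡.refl
  ... | no  _ = ≡.sym (ℤ.*-zeroʳ a)

  δ : ℕ → ℕ → ℤ
  δ zero    = 1#
  δ (suc r) = 0#

  δ-suc : ∀ r m → δ r (suc m) ≡ 0ℤ
  δ-suc zero    m = ≡.refl
  δ-suc (suc r) m = ≡.refl

  Δc-suc : ∀ r m → Δc (suc r) (suc m) ≡ Δc (suc r) m ℕ.+ c r (suc m)
  Δc-suc zero    m = ≡.refl
  Δc-suc (suc r) m = ≡.refl

  module _ {c ℓ} (R : CommutativeRing c ℓ) where
    private module R = CommutativeRing R
    open import Algebra.Solver.Ring.NaturalCoefficients.Default R.commutativeSemiring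
      using (solve; _:+_; _:*_; _:=_; con)

    expand-square : ∀ y u v w → (R.1# R.+ y) R.* (R.1# R.+ y) R.* u R.+ y R.* v R.+ y R.* w R.≈
                    u R.+ (y R.* u R.+ y R.* u R.+ y R.* (y R.* u)) R.+ y R.* v R.+ y R.* w
    expand-square = solve 4 (λ y u v w → (con 1 :+ y) :* (con 1 :+ y) :* u :+ y :* v :+ y :* w :=
                       u :+ (y :* u :+ y :* u :+ y :* (y :* u)) :+ y :* v :+ y :* w) R.refl

  module _ (i : ℕ) .{{_ : ℕ.NonZero i}} where

    private
      η = -1ℤ ℤ.^ i

    -- Multiplication by (-q)^i, for series in the variable q^i.
    shiftScale : (ℕ → ℤ) → ℕ → ℤ
    shiftScale u m = η ℤ.* shift 1 u m

    [-q]^-expand : ∀ u → [-q]^ i * expand i u ≈ expand i (shiftScale u)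
    [-q]^-expand u n = ≡.trans ([-q]^-⊛ i (expand i u) n)
      (≡.trans (≡.cong (η ℤ.*_) (shift-expand i u n)) (≡.sym (expand-scale i η _ n)))

    1≈expand : 1# ≈ expand i 1#
    1≈expand zero    = ≡.sym (expand-* i 1# 0)
    1≈expand (suc n) with i ∣? suc n
    ... | yes (divides zero    ())
    ... | yes (divides (suc m) _) = ≡.refl
    ... | no  _                   = ≡.refl

    -- Here t = - (-q)^i, so t^m is q^(im) with sign `(- η) ^ m`.
    signed : ℕ → ℕ → ℤ
    signed r m = (ℤ.- η) ℤ.^ m ℤ.* ℤ.+ c r m

    Λ : ℤ[[q]][[x]].Series
    Λ r = expand i (signed r)

    -- With y = (-q)^i, this is the coefficient of x^(r+1) q^(im) in ((1 + y)² + x y) Λ_i + x y = 0,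
    -- the square being multiplied out.
    signed-recurrence : ∀ r m →
      signed (suc r) m ℤ.+ (shiftScale (signed (suc r)) m ℤ.+ shiftScale (signed (suc r)) m ℤ.+
      shiftScale (shiftScale (signed (suc r))) m) ℤ.+ shiftScale (signed r) m ℤ.+
      shiftScale (δ r) m ≡ 0ℤ
    signed-recurrence r zero = lemma η
      where
      lemma : ∀ e → 1ℤ ℤ.* 0ℤ ℤ.+ (e ℤ.* 0ℤ ℤ.+ e ℤ.* 0ℤ ℤ.+ e ℤ.* 0ℤ) ℤ.+ e ℤ.* 0ℤ ℤ.+ e ℤ.* 0ℤ ≡ 0ℤ
      lemma = solve-∀
    signed-recurrence zero (suc zero) = lemma η
      where
      lemma : ∀ e → (ℤ.- e ℤ.* 1ℤ) ℤ.* 1ℤ ℤ.+ (e ℤ.* (1ℤ ℤ.* 0ℤ) ℤ.+ e ℤ.* (1ℤ ℤ.* 0ℤ) ℤ.+ e ℤ.* (e ℤ.* 0ℤ)) ℤ.+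
              e ℤ.* (1ℤ ℤ.* 0ℤ) ℤ.+ e ℤ.* 1ℤ ≡ 0ℤ
      lemma = solve-∀
    signed-recurrence (suc r) (suc zero) = lemma η
      where
      lemma : ∀ e → (ℤ.- e ℤ.* 1ℤ) ℤ.* 0ℤ ℤ.+ (e ℤ.* (1ℤ ℤ.* 0ℤ) ℤ.+ e ℤ.* (1ℤ ℤ.* 0ℤ) ℤ.+ e ℤ.* (e ℤ.* 0ℤ)) ℤ.+
              e ℤ.* (1ℤ ℤ.* 0ℤ) ℤ.+ e ℤ.* 0ℤ ≡ 0ℤ
      lemma = solve-∀
    signed-recurrence r (suc (suc m)) rewrite Δc-suc r m | δ-suc r m =
      lemma η ((ℤ.- η) ℤ.^ m) (ℤ.+ c (suc r) m) (ℤ.+ Δc (suc r) m) (ℤ.+ c r (suc m))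
      where
      lemma : ∀ e a C D C′ →
        ℤ.- e ℤ.* (ℤ.- e ℤ.* a) ℤ.* (C ℤ.+ D ℤ.+ (D ℤ.+ C′)) ℤ.+
        (e ℤ.* (ℤ.- e ℤ.* a ℤ.* (C ℤ.+ D)) ℤ.+ e ℤ.* (ℤ.- e ℤ.* a ℤ.* (C ℤ.+ D)) ℤ.+ e ℤ.* (e ℤ.* (a ℤ.* C))) ℤ.+
        e ℤ.* (ℤ.- e ℤ.* a ℤ.* C′) ℤ.+ e ℤ.* 0ℤ ≡ 0ℤ
      lemma = solve-∀

    private
      y : ℤ[[q]].Series
      y = [-q]^ i

    θ-pairFactor : ∀ r → θ (pairFactor i) (suc r) ≈ y * expand i (δ r)
    θ-pairFactor zero    n = ≡.trans (ℤ.+-identityʳ (y n))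
      (≡.sym (≡.trans (*-congˡ {y} (λ n → ≡.sym (1≈expand n)) n) (*-identityʳ y n)))
    θ-pairFactor (suc r) n = ≡.trans (×-zeroʳ (2 ℕ.+ r) n)
      (≡.sym (≡.trans (*-congˡ {y} (expand-0 i) n) (zeroʳ y n)))
      where
      ×-zeroʳ : ∀ k n → (k · (λ _ → 0ℤ)) n ≡ 0ℤ
      ×-zeroʳ zero    n = ≡.refl
      ×-zeroʳ (suc k) n = ≡.trans (ℤ.+-identityˡ _) (×-zeroʳ k n)

    Λ₀ : Λ 0 ≈ 0#
    Λ₀ n = ≡.trans (expand-cong i (λ m → ≡.trans (≡.cong (λ a → (ℤ.- η) ℤ.^ m ℤ.* ℤ.+ a) (c-zero m))
                                                (ℤ.*-zeroʳ ((ℤ.- η) ℤ.^ m))) n) (expand-0 i n)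

    -- `Λ` is minus the logarithmic derivative of `pairFactor i`, in a form without division.
    pairFactor-Λ : ∀ r → (pairFactor i ⊛ Λ) r + θ (pairFactor i) r ≈ 0#
    pairFactor-Λ zero    n = ≡.trans (ℤ.+-identityʳ _) (≡.trans
      (*-congˡ {(1# + y) * (1# + y)} {Λ 0} {0#} Λ₀ n) (zeroʳ ((1# + y) * (1# + y)) n))
    pairFactor-Λ (suc r) n = begin
      (pairFactor i ⊛ Λ) (suc r) n ℤ.+ θ (pairFactor i) (suc r) n
        ≡⟨ ≡.cong₂ ℤ._+_ (ℤ[[q]][[x]].linear-⊛-suc ((1# + y) * (1# + y)) y Λ r n) (θ-pairFactor r n) ⟩
      ((1# + y) * (1# + y) * U + y * V + y * W) n
        ≡⟨ expand-square ℤ[[q]]-ring y U V W n ⟩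
      (U + (y * U + y * U + y * (y * U)) + y * V + y * W) n
        ≡⟨ ≡.cong₂ ℤ._+_ (≡.cong₂ ℤ._+_ (≡.cong (ℤ._+_ (U n)) (≡.cong₂ ℤ._+_
             (≡.cong₂ ℤ._+_ ([-q]^-expand u n) ([-q]^-expand u n))
             (≡.trans (*-congˡ {y} ([-q]^-expand u) n) ([-q]^-expand (shiftScale u) n))))
             ([-q]^-expand v n)) ([-q]^-expand (δ r) n) ⟩
      (U + (expand i su + expand i su + expand i ssu) + expand i (shiftScale v) + expand i (shiftScale (δ r))) n
        ≡⟨ ≡.cong (λ a → U n ℤ.+ (a ℤ.+ expand i ssu n) ℤ.+ expand i (shiftScale v) n ℤ.+ expand i (shiftScale (δ r)) n)
             (expand-+ i su su n) ⟨
      U n ℤ.+ (expand i (λ m → su m ℤ.+ su m) n ℤ.+ expand i ssu n) ℤ.+ expand i (shiftScale v) n ℤ.+ expand i (shiftScale (δ r)) n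
        ≡⟨ ≡.cong (λ a → U n ℤ.+ a ℤ.+ expand i (shiftScale v) n ℤ.+ expand i (shiftScale (δ r)) n)
             (expand-+ i (λ m → su m ℤ.+ su m) ssu n) ⟨
      U n ℤ.+ expand i (λ m → su m ℤ.+ su m ℤ.+ ssu m) n ℤ.+ expand i (shiftScale v) n ℤ.+ expand i (shiftScale (δ r)) n
        ≡⟨ ≡.cong (λ a → a ℤ.+ expand i (shiftScale v) n ℤ.+ expand i (shiftScale (δ r)) n)
             (expand-+ i u (λ m → su m ℤ.+ su m ℤ.+ ssu m) n) ⟨
      expand i (λ m → u m ℤ.+ (su m ℤ.+ su m ℤ.+ ssu m)) n ℤ.+ expand i (shiftScale v) n ℤ.+ expand i (shiftScale (δ r)) n
        ≡⟨ ≡.cong (λ a → a ℤ.+ expand i (shiftScale (δ r)) n)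
             (expand-+ i (λ m → u m ℤ.+ (su m ℤ.+ su m ℤ.+ ssu m)) (shiftScale v) n) ⟨
      expand i (λ m → u m ℤ.+ (su m ℤ.+ su m ℤ.+ ssu m) ℤ.+ shiftScale v m) n ℤ.+ expand i (shiftScale (δ r)) n
        ≡⟨ expand-+ i (λ m → u m ℤ.+ (su m ℤ.+ su m ℤ.+ ssu m) ℤ.+ shiftScale v m) (shiftScale (δ r)) n ⟨
      expand i (λ m → u m ℤ.+ (su m ℤ.+ su m ℤ.+ ssu m) ℤ.+ shiftScale v m ℤ.+ shiftScale (δ r) m) n
        ≡⟨ expand-cong i (signed-recurrence r) n ⟩
      expand i (λ _ → 0ℤ) n
        ≡⟨ expand-0 i n ⟩
      0ℤ ∎
      where
      open ≡.≡-Reasoning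
      u v su ssu : ℕ → ℤ
      u = signed (suc r)
      v = signed r
      su = shiftScale u
      ssu = shiftScale su
      U V W : ℤ[[q]].Series
      U = expand i u
      V = expand i v
      W = expand i (δ r)

  module _ {c ℓ} (R : CommutativeRing c ℓ) where
    private module R = CommutativeRing R
    open import Relation.Binary.Reasoning.Setoid R.setoid
    open import Algebra.Solver.Ring.NaturalCoefficients.Default R.commutativeSemiring
      using (solve; _:+_; _:*_; _:=_)

    -- In f = q e f′ the factor e is constant in x, so the Leibniz rule gives df′/f′ = l - dq/q = l
    -- + λ′. The factors q and e stay in the conclusion, to be cancelled where they are known to
    -- have constant term 1.
    logarithmicDerivative-* : ∀ q dq e l λ′ f f′ df df′ →
      f R.≈ q R.* (e R.* f′) → df R.≈ dq R.* (e R.* f′) R.+ q R.* (e R.* df′) →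
      df R.≈ l R.* f → q R.* λ′ R.+ dq R.≈ R.0# →
      q R.* (e R.* df′) R.≈ q R.* (e R.* ((l R.+ λ′) R.* f′))
    logarithmicDerivative-* q dq e l λ′ f f′ df df′ f≈ df≈ ih qλ = begin
      q R.* (e R.* df′)
        ≈⟨ R.trans (R.+-congʳ (R.trans (R.*-congʳ qλ) (R.zeroˡ _))) (R.+-identityˡ _) ⟨
      (q R.* λ′ R.+ dq) R.* (e R.* f′) R.+ q R.* (e R.* df′)
        ≈⟨ solve 4 (λ a b c d → (a :+ b) :* c :+ d := a :* c :+ (b :* c :+ d)) R.refl
             (q R.* λ′) dq (e R.* f′) (q R.* (e R.* df′)) ⟩
      q R.* λ′ R.* (e R.* f′) R.+ (dq R.* (e R.* f′) R.+ q R.* (e R.* df′))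
        ≈⟨ R.+-congˡ (R.trans (R.trans (R.sym df≈) ih) (R.*-congˡ f≈)) ⟩
      q R.* λ′ R.* (e R.* f′) R.+ l R.* (q R.* (e R.* f′))
        ≈⟨ solve 5 (λ q e l λ′ f′ → q :* λ′ :* (e :* f′) :+ l :* (q :* (e :* f′)) :=
             q :* (e :* ((l :+ λ′) :* f′))) R.refl q e l λ′ f′ ⟩
      q R.* (e R.* ((l R.+ λ′) R.* f′)) ∎

  *-cancelˡ-unit : ∀ {u} → u ≡ 1ℤ → ∀ a b → u ℤ.* a ≡ u ℤ.* b → a ≡ b
  *-cancelˡ-unit ≡.refl a b eq =
    ≡.trans (≡.sym (ℤ.*-identityˡ a)) (≡.trans eq (ℤ.*-identityˡ b))

  unit-cancelˡ : ∀ {p : ℤ[[q]].Series} → p 0 ≡ 1ℤ → ∀ x y → p * x ≈ p * y → x ≈ y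
  unit-cancelˡ {p} p₀ x y = ℤ[[q]].⊛-cancelˡ {p} {x} {y} (*-cancelˡ-unit p₀)

  unit-cancelˡ-≤ : ∀ {p p′ a b : ℤ[[q]].Series} k → p 0 ≡ 1ℤ → p ≈[ k ] p′ →
                   p * a ≈[ k ] p′ * b → a ≈[ k ] b
  unit-cancelˡ-≤ {p} {p′} {a} {b} k p₀ = ℤ[[q]].⊛-cancelˡ-≤ {p} {p′} {a} {b} (*-cancelˡ-unit p₀) k

  [-q]^-0 : ∀ i → [-q]^ (suc i) 0 ≡ 0ℤ
  [-q]^-0 i = ℤ.*-zeroʳ (-1ℤ ℤ.^ suc i)

  logDerivative : ℕ → ℤ[[q]][[x]].Series
  logDerivative zero    = A.0#
  logDerivative (suc N) = logDerivative N A.+ Λ (suc N)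

  module _ (F : ℕ → ℤ[[q]][[x]].Series) (e : ℕ → ℤ[[q]].Series)
           (F-0 : F 0 ≋ A.1#) (e-0 : ∀ N → e (suc N) 0 ≡ 1ℤ)
           (F-suc : ∀ N → F N ≋ pairFactor (suc N) ⊛ (const (e (suc N)) ⊛ F (suc N))) where

    -- Both numbers of colors are covered, `e` being the contribution of a third color. As `F-suc`
    -- gives `F N` in terms of `F (suc N)`, the induction goes upwards by cancelling the new
    -- factors.
    θ≋logDerivative : ∀ N → θ (F N) ≋ logDerivative N ⊛ F N
    θ≋logDerivative zero j n = ≡.trans (ℤ[[q]][[x]].θ-cong {F 0} {A.1#} F-0 j n)
      (≡.trans (θ1 j n) (≡.sym (ℤ[[q]][[x]].0⊛ (F 0) j n)))
      where
      ·-zeroʳ : ∀ k n → (k · 0#) n ≡ 0ℤ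
      ·-zeroʳ zero    n = ≡.refl
      ·-zeroʳ (suc k) n = ≡.trans (ℤ.+-identityˡ _) (·-zeroʳ k n)
      θ1 : θ A.1# ≋ A.0#
      θ1 zero    n = ≡.refl
      θ1 (suc j) n = ·-zeroʳ (suc j) n
    θ≋logDerivative (suc N) =
      ℤ[[q]][[x]].⊛-cancelˡ {E} {θ F′} {(L A.+ Λ (suc N)) ⊛ F′} (unit-cancelˡ (e-0 N))
        (ℤ[[q]][[x]].⊛-cancelˡ {Q} {E ⊛ θ F′} {E ⊛ ((L A.+ Λ (suc N)) ⊛ F′)} (unit-cancelˡ Q₀)
          (logarithmicDerivative-* ℤ[[q]][[x]].seriesRing Q (θ Q) E L (Λ (suc N)) (F N) F′ (θ (F N)) (θ F′)
            (F-suc N) θF (θ≋logDerivative N) (pairFactor-Λ (suc N))))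
      where
      L = logDerivative N
      Q = pairFactor (suc N)
      E = const (e (suc N))
      F′ = F (suc N)
      Q₀ : ((1# + [-q]^ (suc N)) * (1# + [-q]^ (suc N))) 0 ≡ 1ℤ
      Q₀ = ≡.cong (λ a → (1ℤ ℤ.+ a) ℤ.* (1ℤ ℤ.+ a)) ([-q]^-0 N)
      θF : θ (F N) ≋ (θ Q ⊛ (E ⊛ F′)) A.+ (Q ⊛ (E ⊛ θ F′))
      θF = A.trans {θ (F N)} {θ (Q ⊛ (E ⊛ F′))} (ℤ[[q]][[x]].θ-cong {F N} {Q ⊛ (E ⊛ F′)} (F-suc N))
        (A.trans {θ (Q ⊛ (E ⊛ F′))} {(θ Q ⊛ (E ⊛ F′)) A.+ (Q ⊛ θ (E ⊛ F′))} (ℤ[[q]][[x]].θ-⊛ Q (E ⊛ F′))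
          (A.+-congˡ {θ Q ⊛ (E ⊛ F′)} (A.*-congˡ {Q} {θ (E ⊛ F′)} {E ⊛ θ F′} (ℤ[[q]][[x]].θ-const-⊛ (e (suc N)) F′))))

  -- Nonnegativity of the logarithmic derivative

  prefix : ℕ → ℕ → ℕ → ℤ
  prefix zero    r n = 0ℤ
  prefix (suc M) r n = prefix M r n ℤ.+ expand (suc M ℕ.* 2) (λ m → ℤ.+ c r m) n

  prefix-mono : ∀ {M N} → M ≤ N → ∀ r n → prefix M r n ℤ.≤ prefix N r n
  prefix-mono {M} M≤N r n with ℕ.m≤n⇒∃[o]m+o≡n M≤N
  ... | o , ≡.refl = go o
    where
    go : ∀ o → prefix M r n ℤ.≤ prefix (M ℕ.+ o) r n
    go zero    = ℤ.≤-reflexive (≡.cong (λ M → prefix M r n) (≡.sym (ℕ.+-identityʳ M)))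
    go (suc o) = begin
      prefix M r n             ≤⟨ go o ⟩
      prefix (M ℕ.+ o) r n     ≡⟨ ℤ.+-identityʳ _ ⟨
      prefix (M ℕ.+ o) r n ℤ.+ 0ℤ
        ≤⟨ ℤ.+-monoʳ-≤ (prefix (M ℕ.+ o) r n) (expand-nonNeg (suc (M ℕ.+ o) ℕ.* 2) {λ m → ℤ.+ c r m} (λ _ → ℤ.+≤+ z≤n) n) ⟩
      prefix (suc (M ℕ.+ o)) r n ≡⟨ ≡.cong (λ M → prefix M r n) (ℕ.+-suc M o) ⟨
      prefix (M ℕ.+ suc o) r n ∎
      where open ℤ.≤-Reasoning

  -1^even : ∀ M → -1ℤ ℤ.^ (M ℕ.* 2) ≡ 1ℤ
  -1^even zero    = ≡.refl
  -1^even (suc M) = ≡.cong (λ a → -1ℤ ℤ.* (-1ℤ ℤ.* a)) (-1^even M)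

  -1^odd : ∀ M → -1ℤ ℤ.^ suc (M ℕ.* 2) ≡ -1ℤ
  -1^odd M = ≡.cong (-1ℤ ℤ.*_) (-1^even M)

  c≤c-double : ∀ r m → c r m ≤ c r (m ℕ.* 2)
  c≤c-double r m = c-mono r (ℕ.≤-trans (ℕ.≤-reflexive (≡.sym (ℕ.*-identityʳ m))) (ℕ.*-monoʳ-≤ m (s≤s z≤n)))

  Λ-odd-≥ : ∀ M r n → expand (suc (M ℕ.* 2) ℕ.* 2) (λ m → ℤ.+ c r m) n ℤ.≤ Λ (suc (M ℕ.* 2)) r n
  Λ-odd-≥ M r n = ℤ.≤-trans
    (expand-≤ (suc (M ℕ.* 2)) {λ m → ℤ.+ c r m} (λ m → ℤ.+≤+ z≤n) (λ m → ℤ.+≤+ (c≤c-double r m)) n)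
    (ℤ.≤-reflexive (expand-cong (suc (M ℕ.* 2)) (λ m → ≡.sym (≡.trans
      (≡.cong (ℤ._* ℤ.+ c r m) (≡.trans (≡.cong (λ a → (ℤ.- a) ℤ.^ m) (-1^odd M)) (ℤ.^-zeroˡ m)))
      (ℤ.*-identityˡ (ℤ.+ c r m)))) n))

  -1^-cases : ∀ m → -1ℤ ℤ.^ m ≡ 1ℤ ⊎ -1ℤ ℤ.^ m ≡ -1ℤ
  -1^-cases zero = inj₁ ≡.refl
  -1^-cases (suc m) with -1^-cases m
  ... | inj₁ eq = inj₂ (≡.cong (-1ℤ ℤ.*_) eq)
  ... | inj₂ eq = inj₁ (≡.cong (-1ℤ ℤ.*_) eq)

  -- On the right, odd multiples of i cancel and even ones double, and 2 c_r(2m) ≥ c_r(m).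
  Λ-even-≥ : ∀ M r n → let i = suc M ℕ.* 2 in
    expand (i ℕ.* 2) (λ m → ℤ.+ c r m) n ℤ.≤ Λ i r n ℤ.+ expand i (λ m → ℤ.+ c r m) n
  Λ-even-≥ M r n = ℤ.≤-trans (expand-≤ i {u} {λ m → ℤ.+ c r m} u≥0 c≤u n)
    (ℤ.≤-reflexive (expand-+ i (signed i r) (λ m → ℤ.+ c r m) n))
    where
    i = suc M ℕ.* 2
    u : ℕ → ℤ
    u m = signed i r m ℤ.+ ℤ.+ c r m
    signed≡ : ∀ m → signed i r m ≡ -1ℤ ℤ.^ m ℤ.* ℤ.+ c r m
    signed≡ m = ≡.cong (λ a → (ℤ.- a) ℤ.^ m ℤ.* ℤ.+ c r m) (-1^even (suc M))
    u≥0 : ∀ m → 0ℤ ℤ.≤ u m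
    u≥0 m with -1^-cases m
    ... | inj₁ eq = ℤ.≤-trans (ℤ.+≤+ z≤n) (ℤ.≤-reflexive (≡.sym (≡.cong (ℤ._+ ℤ.+ c r m)
      (≡.trans (signed≡ m) (≡.trans (≡.cong (ℤ._* ℤ.+ c r m) eq) (ℤ.*-identityˡ (ℤ.+ c r m)))))))
    ... | inj₂ eq = ℤ.≤-reflexive (≡.sym (≡.trans (≡.cong (ℤ._+ ℤ.+ c r m)
      (≡.trans (signed≡ m) (≡.trans (≡.cong (ℤ._* ℤ.+ c r m) eq) (ℤ.-1*i≡-i (ℤ.+ c r m))))) (ℤ.+-inverseˡ (ℤ.+ c r m))))
    c≤u : ∀ m → ℤ.+ c r m ℤ.≤ u (m ℕ.* 2)
    c≤u m = begin
      ℤ.+ c r m                    ≤⟨ ℤ.+≤+ (ℕ.≤-trans (c≤c-double r m) (ℕ.m≤m+n C C)) ⟩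
      ℤ.+ C ℤ.+ ℤ.+ C              ≡⟨ ≡.cong (ℤ._+ ℤ.+ C) (≡.trans (signed≡ (m ℕ.* 2))
                                        (≡.trans (≡.cong (ℤ._* ℤ.+ C) (-1^even m)) (ℤ.*-identityˡ (ℤ.+ C)))) ⟨
      u (m ℕ.* 2)                  ∎
      where
      open ℤ.≤-Reasoning
      C = c r (m ℕ.* 2)

  -- Induction on M adds one odd and one even index. The term borrowed for the even index 2M + 2 is
  -- precisely the new summand of `prefix (suc M)`.
  prefix≤logDerivative : ∀ M r n →
    prefix (M ℕ.* 2) r n ℤ.≤ logDerivative (M ℕ.* 2) r n ℤ.+ prefix M r n
  prefix≤logDerivative zero    r n = ℤ.≤-refl
  prefix≤logDerivative (suc M) r n = begin
    prefix (M ℕ.* 2) r n ℤ.+ a ℤ.+ b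
      ≤⟨ ℤ.+-mono-≤ (ℤ.+-mono-≤ (prefix≤logDerivative M r n) (Λ-odd-≥ M r n)) (Λ-even-≥ M r n) ⟩
    logDerivative (M ℕ.* 2) r n ℤ.+ prefix M r n ℤ.+ Λ (suc (M ℕ.* 2)) r n ℤ.+ (Λ (suc M ℕ.* 2) r n ℤ.+ d)
      ≡⟨ lemma (logDerivative (M ℕ.* 2) r n) (prefix M r n) (Λ (suc (M ℕ.* 2)) r n) (Λ (suc M ℕ.* 2) r n) d ⟩
    logDerivative (suc M ℕ.* 2) r n ℤ.+ prefix (suc M) r n ∎
    where
    open ℤ.≤-Reasoning
    a = expand (suc (M ℕ.* 2) ℕ.* 2) (λ m → ℤ.+ c r m) n
    b = expand (suc M ℕ.* 2 ℕ.* 2) (λ m → ℤ.+ c r m) n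
    d = expand (suc M ℕ.* 2) (λ m → ℤ.+ c r m) n
    lemma : ∀ l p s t d → l ℤ.+ p ℤ.+ s ℤ.+ (t ℤ.+ d) ≡ l ℤ.+ s ℤ.+ t ℤ.+ (p ℤ.+ d)
    lemma = solve-∀

  logDerivative-nonNeg : ∀ M r n → 0ℤ ℤ.≤ logDerivative (M ℕ.* 2) r n
  logDerivative-nonNeg M r n = begin
    0ℤ                                            ≡⟨ ℤ.+-inverseʳ p ⟨
    p ℤ.- p                                       ≤⟨ ℤ.+-monoˡ-≤ (ℤ.- p) (ℤ.≤-trans
                                                       (prefix-mono (ℕ.m≤m*n M 2) r n) (prefix≤logDerivative M r n)) ⟩
    logDerivative (M ℕ.* 2) r n ℤ.+ p ℤ.- p       ≡⟨ lemma (logDerivative (M ℕ.* 2) r n) p ⟩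
    logDerivative (M ℕ.* 2) r n                   ∎
    where
    open ℤ.≤-Reasoning
    p = prefix M r n
    lemma : ∀ a p → a ℤ.+ p ℤ.- p ≡ a
    lemma = solve-∀

  -- Only `Λ 1` has a term in q^1, since no larger i divides 1.
  logDerivative-1-1 : ∀ N → logDerivative (suc N) 1 1 ≡ 1ℤ
  logDerivative-1-1 zero    = ≡.refl
  logDerivative-1-1 (suc N) = ≡.trans
    (≡.cong₂ ℤ._+_ (logDerivative-1-1 N) (expand-∤ {suc (suc N)} (signed (suc (suc N)) 1) (>⇒∤ (s≤s (s≤s z≤n)))))
    (ℤ.+-identityʳ 1ℤ)

  logDerivative-0 : ∀ N → logDerivative N 0 ≈ 0#
  logDerivative-0 zero    n = ≡.refl
  logDerivative-0 (suc N) n = ≡.cong₂ ℤ._+_ (logDerivative-0 N n) (Λ₀ (suc N) n)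

  -- Positivity propagated from x^0 to all powers of x

  +-nonNeg : ∀ {a b} → 0ℤ ℤ.≤ a → 0ℤ ℤ.≤ b → 0ℤ ℤ.≤ a ℤ.+ b
  +-nonNeg = ℤ.+-mono-≤

  ≤-+ʳ : ∀ {a b} → 0ℤ ℤ.≤ b → a ℤ.≤ a ℤ.+ b
  ≤-+ʳ {a} b≥0 = ℤ.≤-trans (ℤ.≤-reflexive (≡.sym (ℤ.+-identityʳ a))) (ℤ.+-monoʳ-≤ a b≥0)

  ≤-+ˡ : ∀ {a b} → 0ℤ ℤ.≤ a → b ℤ.≤ a ℤ.+ b
  ≤-+ˡ {a} {b} a≥0 = ℤ.≤-trans (≤-+ʳ a≥0) (ℤ.≤-reflexive (ℤ.+-comm b a))

  *-nonNeg : ∀ {a b} → 0ℤ ℤ.≤ a → 0ℤ ℤ.≤ b → 0ℤ ℤ.≤ a ℤ.* b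
  *-nonNeg {ℤ.+ a} {ℤ.+ b} _ _ = ℤ.≤-trans (ℤ.+≤+ z≤n) (ℤ.≤-reflexive (ℤ.pos-* a b))

  *-nonNeg-series : ∀ {a b : ℤ[[q]].Series} n → (∀ i → 0ℤ ℤ.≤ a i) → (∀ {i} → i ≤ n → 0ℤ ℤ.≤ b i) →
                    0ℤ ℤ.≤ (a * b) n
  *-nonNeg-series zero    a≥0 b≥0 = *-nonNeg (a≥0 0) (b≥0 z≤n)
  *-nonNeg-series (suc n) a≥0 b≥0 = +-nonNeg (*-nonNeg (a≥0 0) (b≥0 ℕ.≤-refl))
    (*-nonNeg-series n (λ i → a≥0 (suc i)) (λ h → b≥0 (ℕ.m≤n⇒m≤1+n h)))

  *-series-≥₀ : ∀ {a b : ℤ[[q]].Series} n → (∀ i → 0ℤ ℤ.≤ a i) → (∀ {i} → i ≤ n → 0ℤ ℤ.≤ b i) →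
                a 0 ℤ.* b n ℤ.≤ (a * b) n
  *-series-≥₀ zero    a≥0 b≥0 = ℤ.≤-refl
  *-series-≥₀ (suc n) a≥0 b≥0 =
    ≤-+ʳ (*-nonNeg-series n (λ i → a≥0 (suc i)) (λ h → b≥0 (ℕ.m≤n⇒m≤1+n h)))

  *-series-≥₁ : ∀ {a b : ℤ[[q]].Series} n → (∀ i → 0ℤ ℤ.≤ a i) → (∀ {i} → i ≤ suc n → 0ℤ ℤ.≤ b i) →
                a 1 ℤ.* b n ℤ.≤ (a * b) (suc n)
  *-series-≥₁ n a≥0 b≥0 = ℤ.≤-trans
    (*-series-≥₀ n (λ i → a≥0 (suc i)) (λ h → b≥0 (ℕ.m≤n⇒m≤1+n h)))
    (≤-+ˡ (*-nonNeg (a≥0 0) (b≥0 ℕ.≤-refl)))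

  ⊛-nonNeg : ∀ {a b : ℤ[[q]][[x]].Series} j n → (∀ r i → 0ℤ ℤ.≤ a r i) →
             (∀ {r i} → r ≤ j → i ≤ n → 0ℤ ℤ.≤ b r i) → 0ℤ ℤ.≤ (a ⊛ b) j n
  ⊛-nonNeg zero    n a≥0 b≥0 = *-nonNeg-series n (a≥0 0) (b≥0 z≤n)
  ⊛-nonNeg (suc j) n a≥0 b≥0 = +-nonNeg (*-nonNeg-series n (a≥0 0) (b≥0 ℕ.≤-refl))
    (⊛-nonNeg j n (λ r → a≥0 (suc r)) (λ h → b≥0 (ℕ.m≤n⇒m≤1+n h)))

  ⊛-≥₀ : ∀ {a b : ℤ[[q]][[x]].Series} j n → (∀ r i → 0ℤ ℤ.≤ a r i) →
         (∀ {r i} → r ≤ j → i ≤ n → 0ℤ ℤ.≤ b r i) → (a 0 * b j) n ℤ.≤ (a ⊛ b) j n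
  ⊛-≥₀ zero    n a≥0 b≥0 = ℤ.≤-refl
  ⊛-≥₀ (suc j) n a≥0 b≥0 =
    ≤-+ʳ (⊛-nonNeg j n (λ r → a≥0 (suc r)) (λ h → b≥0 (ℕ.m≤n⇒m≤1+n h)))

  ·-coeff : ∀ k (a : ℤ[[q]].Series) n → (k · a) n ≡ ℤ.+ k ℤ.* a n
  ·-coeff zero    a n = ≡.refl
  ·-coeff (suc k) a n = ≡.trans (≡.cong (ℤ._+_ (a n)) (·-coeff k a n)) (≡.sym (ℤ.suc-* (ℤ.+ k) (a n)))

  module _ {F L : ℤ[[q]][[x]].Series} (θF : θ F ≋ L ⊛ F) (L-0 : L 0 ≈ 0#)
           (L≥0 : ∀ r n → 0ℤ ℤ.≤ L r n) (L-1-1 : L 1 1 ≡ 1ℤ)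
           {K : ℕ} (F₀>0 : ∀ {n} → n ≤ K → 0ℤ ℤ.< F 0 n) where

    private
      L⁺ : ℤ[[q]][[x]].Series
      L⁺ = ℤ[[q]][[x]].shiftLeft L

    -- Because `L 0` vanishes, `F (suc j)` drops out of the right side of θ F = L F, which leaves a
    -- recursion in j.
    coefficient-suc : ∀ j n → ℤ.+ suc j ℤ.* F (suc j) n ≡ (L⁺ ⊛ F) j n
    coefficient-suc j n = begin
      ℤ.+ suc j ℤ.* F (suc j) n                       ≡⟨ ·-coeff (suc j) (F (suc j)) n ⟨
      θ F (suc j) n                                   ≡⟨ θF (suc j) n ⟩
      (L 0 * F (suc j)) n ℤ.+ (L⁺ ⊛ F) j n            ≡⟨ ≡.cong (ℤ._+ (L⁺ ⊛ F) j n)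
        (≡.trans (*-congʳ {F (suc j)} {L 0} {0#} L-0 n) (zeroˡ (F (suc j)) n)) ⟩
      0ℤ ℤ.+ (L⁺ ⊛ F) j n                             ≡⟨ ℤ.+-identityˡ _ ⟩
      (L⁺ ⊛ F) j n                                    ∎
      where open ≡.≡-Reasoning

    -- Strictness is claimed only for r ≤ n, but the induction also discards terms with r > n and
    -- needs them nonnegative.
    PositiveUpTo : ℕ → Set
    PositiveUpTo j = ∀ {r n} → r ≤ j → n ≤ K → 0ℤ ℤ.≤ F r n × (r ≤ n → 0ℤ ℤ.< F r n)

    positiveUpTo : ∀ j → PositiveUpTo j
    positiveUpTo zero    z≤n n≤K = ℤ.<⇒≤ (F₀>0 n≤K) , λ _ → F₀>0 n≤K
    positiveUpTo (suc j) r≤j n≤K with ℕ.m≤n⇒m<n∨m≡n r≤j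
    ... | inj₁ (s≤s r≤j′) = positiveUpTo j r≤j′ n≤K
    ... | inj₂ ≡.refl = nonNeg n≤K , λ j<n → positive n≤K j<n
      where
      ih≥0 : ∀ {n} → n ≤ K → ∀ {r i} → r ≤ j → i ≤ n → 0ℤ ℤ.≤ F r i
      ih≥0 n≤K r≤j i≤n = proj₁ (positiveUpTo j r≤j (ℕ.≤-trans i≤n n≤K))
      nonNeg : ∀ {n} → n ≤ K → 0ℤ ℤ.≤ F (suc j) n
      nonNeg {n} n≤K = ℤ.*-cancelˡ-≤-pos 0ℤ (F (suc j) n) (ℤ.+ suc j) (ℤ.≤-trans
        (ℤ.≤-reflexive (ℤ.*-zeroʳ (ℤ.+ suc j)))
        (ℤ.≤-trans (⊛-nonNeg j n (λ r → L≥0 (suc r)) (ih≥0 n≤K)) (ℤ.≤-reflexive (≡.sym (coefficient-suc j n)))))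
      positive : ∀ {n} → n ≤ K → suc j ≤ n → 0ℤ ℤ.< F (suc j) n
      positive {suc n} n≤K (s≤s j≤n) = ℤ.*-cancelˡ-<-nonNeg (ℤ.+ suc j) (begin-strict
        ℤ.+ suc j ℤ.* 0ℤ                ≡⟨ ℤ.*-zeroʳ (ℤ.+ suc j) ⟩
        0ℤ                              <⟨ proj₂ (positiveUpTo j ℕ.≤-refl (ℕ.<⇒≤ n≤K)) j≤n ⟩
        F j n                           ≡⟨ ≡.trans (≡.cong (ℤ._* F j n) L-1-1) (ℤ.*-identityˡ (F j n)) ⟨
        -- Of the whole convolution only the x q term of `L` is kept.
        L 1 1 ℤ.* F j n                 ≤⟨ *-series-≥₁ n (L≥0 1) (ih≥0 n≤K ℕ.≤-refl) ⟩
        (L 1 * F j) (suc n)             ≤⟨ ⊛-≥₀ j (suc n) (λ r → L≥0 (suc r)) (ih≥0 n≤K) ⟩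
        (L⁺ ⊛ F) j (suc n)              ≡⟨ coefficient-suc j (suc n) ⟨
        ℤ.+ suc j ℤ.* F (suc j) (suc n) ∎)
        where open ℤ.≤-Reasoning

    coefficients-positive : ∀ {j n} → j ≤ n → n ≤ K → 0ℤ ℤ.< F j n
    coefficients-positive {j} j≤n n≤K = proj₂ (positiveUpTo j ℕ.≤-refl n≤K) j≤n

  -- The coefficient of x^0

  [-q]^-double : ∀ i → [-q]^ i * [-q]^ i ≈ [-q]^ (i ℕ.* 2)
  [-q]^-double i n = begin
    ([-q]^ i * [-q]^ i) n                        ≡⟨ [-q]^-⊛ i ([-q]^ i) n ⟩
    η ℤ.* shift i ([-q]^ i) n                    ≡⟨ ≡.cong (η ℤ.*_) (shift-scale i (ℤ[[q]].X^ i) n) ⟩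
    η ℤ.* (η ℤ.* shift i (ℤ[[q]].X^ i) n)        ≡⟨ ℤ.*-assoc η η _ ⟨
    η ℤ.* η ℤ.* shift i (ℤ[[q]].X^ i) n          ≡⟨ ≡.cong₂ ℤ._*_ (ℤ.^-distribˡ-+-* -1ℤ i i)
                                                      (≡.sym (ℤ[[q]].shift-shift i i 1# n)) ⟨
    [-q]^ (i ℕ.+ i) n                            ≡⟨ ≡.cong (λ k → [-q]^ k n) (double i) ⟩
    [-q]^ (i ℕ.* 2) n                            ∎
    where
    open ≡.≡-Reasoning
    η = -1ℤ ℤ.^ i
    shift-scale : ∀ i a n → shift i (λ n → η ℤ.* a n) n ≡ η ℤ.* shift i a n
    shift-scale zero    a n       = ≡.refl
    shift-scale (suc i) a zero    = ≡.sym (ℤ.*-zeroʳ η)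
    shift-scale (suc i) a (suc n) = shift-scale i a n
    double : ∀ i → i ℕ.+ i ≡ i ℕ.* 2
    double i = ≡.trans (≡.cong (i ℕ.+_) (≡.sym (ℕ.+-identityʳ i))) (ℕ.*-comm 2 i)

  -- V m = ∏ (1 - q^{2i}) and O m = ∏ (1 + q^{2i-1}) over 1 ≤ i ≤ m: odd powers of
  -- -q change sign.
  V O : ℕ → ℤ[[q]].Series
  V zero    = 1#
  V (suc m) = V m * (1# - [-q]^ (suc m ℕ.* 2))
  O zero    = 1#
  O (suc m) = O m * (1# - [-q]^ (suc (m ℕ.* 2)))

  module _ {c ℓ} (R : CommutativeRing c ℓ) where
    private module R = CommutativeRing R
    open import Relation.Binary.Reasoning.Setoid R.setoid
    open import Algebra.Solver.Ring.NaturalCoefficients.Default R.commutativeSemiring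
      using (solve; _:+_; _:*_; _:=_)

    difference-of-squares : ∀ y → (R.1# R.- y) R.* (R.1# R.+ y) R.≈ R.1# R.- y R.* y
    difference-of-squares y = begin
      (R.1# R.- y) R.* (R.1# R.+ y)
        ≈⟨ R.distribʳ (R.1# R.+ y) R.1# (R.- y) ⟩
      R.1# R.* (R.1# R.+ y) R.+ R.- y R.* (R.1# R.+ y)
        ≈⟨ R.+-cong (R.*-identityˡ _) (R.trans (R.distribˡ (R.- y) R.1# y) (R.+-cong (R.*-identityʳ _) (R.sym (-‿distribˡ-* y y)))) ⟩
      R.1# R.+ y R.+ (R.- y R.- y R.* y)
        ≈⟨ solve 4 (λ a b c d → a :+ b :+ (c :+ d) := a :+ d :+ (b :+ c)) R.refl R.1# y (R.- y) (R.- (y R.* y)) ⟩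
      R.1# R.- y R.* y R.+ (y R.- y)
        ≈⟨ R.trans (R.+-congˡ (R.-‿inverseʳ y)) (R.+-identityʳ _) ⟩
      R.1# R.- y R.* y ∎
      where open import Algebra.Properties.Ring R.ring using (-‿distribˡ-*)

    -- Two new indices i, the first odd and the second even in the application, each with 1 - y_(2i)
    -- = z p for z = 1 - y_i and p = 1 + y_i. The p are absorbed by f; z₁ joins the odd product o
    -- and z₂ the even product w.
    telescoping-step : ∀ v c w o f f′ v₁ v₂ z₁ z₂ p₁ p₂ e₁ e₂ →
      v R.* v R.* (c R.* f) R.≈ w R.* w R.* (o R.* o) →
      f R.≈ p₁ R.* p₁ R.* (e₁ R.* (p₂ R.* p₂ R.* (e₂ R.* f′))) →
      v₁ R.≈ z₁ R.* p₁ → v₂ R.≈ z₂ R.* p₂ →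
      (v R.* v₁ R.* v₂) R.* (v R.* v₁ R.* v₂) R.* (c R.* e₁ R.* e₂ R.* f′) R.≈
      (w R.* z₂) R.* (w R.* z₂) R.* ((o R.* z₁) R.* (o R.* z₁))
    telescoping-step v c w o f f′ v₁ v₂ z₁ z₂ p₁ p₂ e₁ e₂ ih f≈ v₁≈ v₂≈ = begin
      (v R.* v₁ R.* v₂) R.* (v R.* v₁ R.* v₂) R.* (c R.* e₁ R.* e₂ R.* f′)
        ≈⟨ R.*-congʳ (R.*-cong v′≈ v′≈) ⟩
      (v R.* (z₁ R.* p₁) R.* (z₂ R.* p₂)) R.* (v R.* (z₁ R.* p₁) R.* (z₂ R.* p₂)) R.* (c R.* e₁ R.* e₂ R.* f′)
        ≈⟨ solve 9 (λ v c z₁ p₁ z₂ p₂ e₁ e₂ f′ →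
             (v :* (z₁ :* p₁) :* (z₂ :* p₂)) :* (v :* (z₁ :* p₁) :* (z₂ :* p₂)) :* (c :* e₁ :* e₂ :* f′) :=
             z₁ :* z₁ :* (z₂ :* z₂) :* (v :* v :* (c :* (p₁ :* p₁ :* (e₁ :* (p₂ :* p₂ :* (e₂ :* f′))))))) R.refl
             v c z₁ p₁ z₂ p₂ e₁ e₂ f′ ⟩
      z₁ R.* z₁ R.* (z₂ R.* z₂) R.* (v R.* v R.* (c R.* (p₁ R.* p₁ R.* (e₁ R.* (p₂ R.* p₂ R.* (e₂ R.* f′))))))
        ≈⟨ R.*-congˡ (R.trans (R.*-congˡ (R.*-congˡ (R.sym f≈))) ih) ⟩
      z₁ R.* z₁ R.* (z₂ R.* z₂) R.* (w R.* w R.* (o R.* o))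
        ≈⟨ solve 4 (λ z₁ z₂ w o → z₁ :* z₁ :* (z₂ :* z₂) :* (w :* w :* (o :* o)) :=
             (w :* z₂) :* (w :* z₂) :* ((o :* z₁) :* (o :* z₁))) R.refl z₁ z₂ w o ⟩
      (w R.* z₂) R.* (w R.* z₂) R.* ((o R.* z₁) R.* (o R.* z₁)) ∎
      where
      v′≈ : v R.* v₁ R.* v₂ R.≈ v R.* (z₁ R.* p₁) R.* (z₂ R.* p₂)
      v′≈ = R.*-cong (R.*-congˡ v₁≈) v₂≈

  V-factor : ∀ i → 1# - [-q]^ (i ℕ.* 2) ≈ (1# - [-q]^ i) * (1# + [-q]^ i)
  V-factor i n = ≡.sym (≡.trans (difference-of-squares ℤ[[q]]-ring ([-q]^ i) n)
    (≡.cong (λ a → 1# n ℤ.- a) ([-q]^-double i n)))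

  -- The product of e i over 1 ≤ i ≤ 2M, taken in pairs to match `telescoping-step`.
  prefixProduct : (ℕ → ℤ[[q]].Series) → ℕ → ℤ[[q]].Series
  prefixProduct e zero    = 1#
  prefixProduct e (suc M) = prefixProduct e M * e (suc (M ℕ.* 2)) * e (suc M ℕ.* 2)

  sub-[-q]^-* : ∀ i a n → ((1# - [-q]^ i) * a) n ≡ a n ℤ.- -1ℤ ℤ.^ i ℤ.* shift i a n
  sub-[-q]^-* i a n = ≡.trans (distribʳ a 1# (- [-q]^ i) n) (≡.cong₂ ℤ._+_ (*-identityˡ a n)
    (≡.trans (≡.sym (-‿distribˡ-* ([-q]^ i) a n)) (≡.cong ℤ.-_ ([-q]^-⊛ i a n))))
    where open import Algebra.Properties.Ring ring using (-‿distribˡ-*)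

  odd-factor-* : ∀ m a n → ((1# - [-q]^ (suc (m ℕ.* 2))) * a) n ≡ a n ℤ.+ shift (suc (m ℕ.* 2)) a n
  odd-factor-* m a n = ≡.trans (sub-[-q]^-* i a n) (≡.trans
    (≡.cong (λ s → a n ℤ.- s ℤ.* shift i a n) (-1^odd m)) (lemma (a n) (shift i a n)))
    where
    i = suc (m ℕ.* 2)
    lemma : ∀ a b → a ℤ.- -1ℤ ℤ.* b ≡ a ℤ.+ b
    lemma = solve-∀

  even-factor-* : ∀ m a n → a n ≡ ((1# - [-q]^ (m ℕ.* 2)) * a) n ℤ.+ shift (m ℕ.* 2) a n
  even-factor-* m a n = ≡.sym (≡.trans (≡.cong (ℤ._+ shift i a n) (≡.trans (sub-[-q]^-* i a n)
    (≡.cong (λ s → a n ℤ.- s ℤ.* shift i a n) (-1^even m)))) (lemma (a n) (shift i a n)))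
    where
    i = m ℕ.* 2
    lemma : ∀ a b → a ℤ.- 1ℤ ℤ.* b ℤ.+ b ≡ a
    lemma = solve-∀

  V-factor-≈ : ∀ {i k} → k < i ℕ.* 2 → 1# - [-q]^ (i ℕ.* 2) ≈[ k ] 1#
  V-factor-≈ {i} {k} k<2i {n} n≤k = ≡.trans (≡.cong (λ a → 1# n ℤ.- -1ℤ ℤ.^ (i ℕ.* 2) ℤ.* a)
    (ℤ[[q]].shift-< 1# (ℕ.≤-<-trans n≤k k<2i)))
    (≡.trans (≡.cong (λ a → 1# n ℤ.- a) (ℤ.*-zeroʳ (-1ℤ ℤ.^ (i ℕ.* 2)))) (ℤ.+-identityʳ (1# n)))

  -- Factors of index i > M differ from 1 only beyond degree 2M.
  V-stable : ∀ M o → V (M ℕ.+ o) ≈[ M ℕ.* 2 ] V M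
  V-stable M zero    {n} h = ≡.cong (λ m → V m n) (ℕ.+-identityʳ M)
  V-stable M (suc o) {n} h = ≡.trans (≡.cong (λ m → V m n) (ℕ.+-suc M o)) (≡.trans
    (ℤ[[q]].⊛-cong-≤ {V (M ℕ.+ o)} {V M} {1# - [-q]^ (suc (M ℕ.+ o) ℕ.* 2)} {1#} (M ℕ.* 2) (V-stable M o)
      (V-factor-≈ {suc (M ℕ.+ o)} (ℕ.*-monoˡ-< 2 (s≤s (ℕ.m≤m+n M o)))) h)
    (*-identityʳ (V M) n))

  V-0 : ∀ M → V M 0 ≡ 1ℤ
  V-0 zero    = ≡.refl
  V-0 (suc M) = ≡.cong₂ ℤ._*_ (V-0 M) (≡.cong (λ a → 1ℤ ℤ.- a) ([-q]^-0 (suc (M ℕ.* 2))))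

  O-0 : ∀ M → O M 0 ≡ 1ℤ
  O-0 zero    = ≡.refl
  O-0 (suc M) = ≡.cong₂ ℤ._*_ (O-0 M) (≡.cong (λ a → 1ℤ ℤ.- a) ([-q]^-0 (M ℕ.* 2)))

  -- Positivity of the truncated products

  shift-nonNeg : ∀ i {a : ℤ[[q]].Series} n → (∀ n → 0ℤ ℤ.≤ a n) → 0ℤ ℤ.≤ shift i a n
  shift-nonNeg zero    n       a≥0 = a≥0 n
  shift-nonNeg (suc i) zero    a≥0 = ℤ.≤-refl
  shift-nonNeg (suc i) (suc n) a≥0 = shift-nonNeg i n a≥0

  odd-factor-nonNeg : ∀ m {a : ℤ[[q]].Series} → (∀ n → 0ℤ ℤ.≤ a n) →
                      ∀ n → 0ℤ ℤ.≤ ((1# - [-q]^ (suc (m ℕ.* 2))) * a) n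
  odd-factor-nonNeg m {a} a≥0 n = ℤ.≤-trans
    (+-nonNeg (a≥0 n) (shift-nonNeg (suc (m ℕ.* 2)) n a≥0))
    (ℤ.≤-reflexive (≡.sym (odd-factor-* m a n)))

  O-suc : ∀ M n → O (suc M) n ≡ O M n ℤ.+ shift (suc (M ℕ.* 2)) (O M) n
  O-suc M n = ≡.trans (*-comm (O M) (1# - [-q]^ (suc (M ℕ.* 2))) n) (odd-factor-* M (O M) n)

  O-nonNeg : ∀ M n → 0ℤ ℤ.≤ O M n
  O-nonNeg zero    zero    = ℤ.+≤+ z≤n
  O-nonNeg zero    (suc n) = ℤ.≤-refl
  O-nonNeg (suc M) n = ℤ.≤-trans (+-nonNeg (O-nonNeg M n) (shift-nonNeg (suc (M ℕ.* 2)) n (O-nonNeg M)))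
    (ℤ.≤-reflexive (≡.sym (O-suc M n)))

  O-1 : ∀ M → 0ℤ ℤ.< O (suc M) 1
  O-1 zero    = ℤ.+<+ (s≤s z≤n)
  O-1 (suc M) = ℤ.<-≤-trans (O-1 M) (ℤ.≤-trans
    (≤-+ʳ (shift-nonNeg (suc (suc M ℕ.* 2)) 1 (O-nonNeg (suc M)))) (ℤ.≤-reflexive (≡.sym (O-suc (suc M) 1))))

  O²-nonNeg : ∀ M n → 0ℤ ℤ.≤ (O M * O M) n
  O²-nonNeg M n = *-nonNeg-series n (O-nonNeg M) (λ {i} _ → O-nonNeg M i)

  O²-suc : ∀ M → let i = suc (M ℕ.* 2) in ∀ n →
    (O (suc M) * O (suc M)) n ≡
    ((O M * O M) n ℤ.+ shift i (O M * O M) n) ℤ.+ shift i ((1# - [-q]^ i) * (O M * O M)) n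
  O²-suc M n = begin
    (O M * z * (O M * z)) n             ≡⟨ rearrange (O M) z n ⟩
    (z * (z * (O M * O M))) n           ≡⟨ odd-factor-* M (z * (O M * O M)) n ⟩
    (z * (O M * O M)) n ℤ.+ shift i (z * (O M * O M)) n
      ≡⟨ ≡.cong (ℤ._+ shift i (z * (O M * O M)) n) (odd-factor-* M (O M * O M) n) ⟩
    ((O M * O M) n ℤ.+ shift i (O M * O M) n) ℤ.+ shift i (z * (O M * O M)) n ∎
    where
    open ≡.≡-Reasoning
    open import Algebra.Solver.Ring.NaturalCoefficients.Default commutativeSemiring
      using (solve; _:*_; _:=_)
    i = suc (M ℕ.* 2)
    z : ℤ[[q]].Series
    z = 1# - [-q]^ i
    rearrange : ∀ o z → o * z * (o * z) ≈ z * (z * (o * o))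
    rearrange = solve 2 (λ o z → o :* z :* (o :* z) := z :* (z :* (o :* o))) refl

  -- The base is (1 + q)² = 1 + 2q + q². Multiplying P by (1 + q^i)² with i = 2M + 3 keeps the old
  -- coefficients positive, and the new degrees i and i + 1 receive the coefficients of P in degrees
  -- 0 and 1.
  O²-positive : ∀ M {n} → n ≤ suc M ℕ.* 2 → 0ℤ ℤ.< (O (suc M) * O (suc M)) n
  O²-positive zero {zero}              _ = ℤ.+<+ (s≤s z≤n)
  O²-positive zero {suc zero}          _ = ℤ.+<+ (s≤s z≤n)
  O²-positive zero {suc (suc zero)}    _ = ℤ.+<+ (s≤s z≤n)
  O²-positive zero {suc (suc (suc n))} (s≤s (s≤s ()))
  O²-positive (suc M) {n} n≤N+2 with n ℕ.≤? suc M ℕ.* 2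
  ... | yes n≤N = ℤ.<-≤-trans (O²-positive M n≤N) (ℤ.≤-trans (≤-+ʳ (shift-nonNeg i n P≥0))
    (ℤ.≤-trans (≤-+ʳ (shift-nonNeg i n zP≥0)) (ℤ.≤-reflexive (≡.sym (O²-suc (suc M) n)))))
    where
    i = suc (suc M ℕ.* 2)
    P = O (suc M) * O (suc M)
    P≥0 = O²-nonNeg (suc M)
    zP≥0 = odd-factor-nonNeg (suc M) P≥0
  ... | no n≰N with ℕ.m≤n⇒∃[o]m+o≡n (ℕ.≰⇒> n≰N)
  ...   | o , ≡.refl = ℤ.<-≤-trans (O²-positive M (ℕ.≤-trans o≤1 (s≤s z≤n))) (ℤ.≤-trans
    (ℤ.≤-reflexive (≡.sym (ℤ[[q]].shift-+ i P o))) (ℤ.≤-trans (≤-+ˡ (P≥0 (i ℕ.+ o)))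
    (ℤ.≤-trans (≤-+ʳ (shift-nonNeg i (i ℕ.+ o) zP≥0)) (ℤ.≤-reflexive (≡.sym (O²-suc (suc M) (i ℕ.+ o)))))))
    where
    i = suc (suc M ℕ.* 2)
    P = O (suc M) * O (suc M)
    P≥0 = O²-nonNeg (suc M)
    zP≥0 = odd-factor-nonNeg (suc M) P≥0
    o≤1 : o ≤ 1
    o≤1 = ℕ.+-cancelˡ-≤ i o 1 (ℕ.≤-trans n≤N+2 (ℕ.≤-reflexive (ℕ.+-comm 1 i)))

  -- Coefficients satisfy f_n = g_n + f_(n-s), so g has to be strictly positive only below s. The
  -- descent is by steps of s, hence the induction on an upper bound for n.
  quotient-positive : ∀ m {f : ℤ[[q]].Series} {k} → let s = suc m ℕ.* 2; g = (1# - [-q]^ s) * f in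
    (∀ {n} → n ≤ k → 0ℤ ℤ.≤ g n) → (∀ {n} → n ≤ k → n < s → 0ℤ ℤ.< g n) →
    ∀ {n} → n ≤ k → 0ℤ ℤ.< f n
  quotient-positive m {f} {k} g≥0 g>0 {n} n≤k = go n ℕ.≤-refl n≤k
    where
    s = suc m ℕ.* 2
    go : ∀ b {n} → n ≤ b → n ≤ k → 0ℤ ℤ.< f n
    go b {n} n≤b n≤k with n ℕ.<? s
    ... | yes n<s = ℤ.<-≤-trans (g>0 n≤k n<s) (ℤ.≤-reflexive (≡.sym (≡.trans (even-factor-* (suc m) f n)
      (≡.trans (≡.cong (ℤ._+_ (((1# - [-q]^ s) * f) n)) (ℤ[[q]].shift-< f n<s)) (ℤ.+-identityʳ _)))))
    ... | no n≮s with ℕ.m≤n⇒∃[o]m+o≡n (ℕ.≮⇒≥ n≮s)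
    go zero    () n≤k | no _ | o , ≡.refl
    go (suc b) (s≤s n≤b) n≤k | no _ | o , ≡.refl = ℤ.<-≤-trans
      (go b (ℕ.≤-trans (ℕ.m≤n+m o (suc (m ℕ.* 2))) n≤b) (ℕ.≤-trans (ℕ.m≤n+m o s) n≤k))
      (ℤ.≤-trans (ℤ.≤-reflexive (≡.sym (ℤ[[q]].shift-+ s f o)))
        (ℤ.≤-trans (≤-+ˡ (g≥0 n≤k)) (ℤ.≤-reflexive (≡.sym (even-factor-* (suc m) f (s ℕ.+ o))))))

  -- Dividing by 1 - q² comes first: it spreads positivity from degrees 0 and 1 to both residue
  -- classes modulo 2. The other factors then divide a series that is already positive. In the
  -- application Y is `O (suc M)`, which has zero coefficients, such as that of q².
  V-quotient-positive : ∀ M {f Y : ℤ[[q]].Series} {k} → V (suc M) * f ≈[ k ] Y →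
    (∀ n → 0ℤ ℤ.≤ Y n) → 0ℤ ℤ.< Y 0 → 0ℤ ℤ.< Y 1 → ∀ {n} → n ≤ k → 0ℤ ℤ.< f n
  V-quotient-positive M {f} {Y} {k} Vf Y≥0 Y₀ Y₁ = go M {f} Vf
    where
    v : ℕ → ℤ[[q]].Series
    v m = 1# - [-q]^ (suc m ℕ.* 2)
    go : ∀ M {f} → V (suc M) * f ≈[ k ] Y → ∀ {n} → n ≤ k → 0ℤ ℤ.< f n
    go zero {f} Vf = quotient-positive 0 {f}
      (λ {n} h → ℤ.≤-trans (Y≥0 n) (ℤ.≤-reflexive (≡.sym (vf h))))
      (λ {n} h n<2 → ℤ.<-≤-trans (Y>0 n n<2) (ℤ.≤-reflexive (≡.sym (vf h))))
      where
      vf : v 0 * f ≈[ k ] Y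
      vf {n} h = ≡.trans (≡.sym (*-congʳ {f} {1# * v 0} {v 0} (*-identityˡ (v 0)) n)) (Vf h)
      Y>0 : ∀ n → n < 2 → 0ℤ ℤ.< Y n
      Y>0 zero       _ = Y₀
      Y>0 (suc zero) _ = Y₁
      Y>0 (suc (suc n)) (s≤s (s≤s ()))
    go (suc M) {f} Vf = quotient-positive (suc M) {f} (λ h → ℤ.<⇒≤ (vf>0 h)) (λ h _ → vf>0 h)
      where
      vf>0 : ∀ {n} → n ≤ k → 0ℤ ℤ.< (v (suc M) * f) n
      vf>0 = go M {v (suc M) * f} (λ {n} h → ≡.trans (≡.sym (*-assoc (V (suc M)) (v (suc M)) f n)) (Vf h))

  -- Euler's identity for finite products

  module _ (f e : ℕ → ℤ[[q]].Series) (f-0 : f 0 ≈ 1#)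
           (f-suc : ∀ N → f N ≈ (1# + [-q]^ (suc N)) * (1# + [-q]^ (suc N)) * (e (suc N) * f (suc N))) where

    -- An exact identity: `V (M * 2)` is the product of (1 - y_i)(1 + y_i) over i ≤ 2M, and the
    -- factors 1 - y_i alone, sorted by the parity of i, form `V M * O M`.
    telescoped : ∀ M → V (M ℕ.* 2) * V (M ℕ.* 2) * (prefixProduct e M * f (M ℕ.* 2)) ≈ V M * V M * (O M * O M)
    telescoped zero    = *-congˡ {1# * 1#} {1# * f 0} {1# * 1#} (*-congˡ {1#} {f 0} {1#} f-0)
    telescoped (suc M) = telescoping-step ℤ[[q]]-ring (V (M ℕ.* 2)) (prefixProduct e M) (V M) (O M) (f N) (f (suc (suc N)))
      (1# - [-q]^ (suc N ℕ.* 2)) (1# - [-q]^ (suc (suc N) ℕ.* 2)) (1# - [-q]^ (suc N)) (1# - [-q]^ (suc (suc N)))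
      (1# + [-q]^ (suc N)) (1# + [-q]^ (suc (suc N))) (e (suc N)) (e (suc (suc N)))
      (telescoped M) f≈ (V-factor (suc N)) (V-factor (suc (suc N)))
      where
      N = M ℕ.* 2
      p₁ p₂ : ℤ[[q]].Series
      p₁ = 1# + [-q]^ (suc N)
      p₂ = 1# + [-q]^ (suc (suc N))
      f≈ : f N ≈ p₁ * p₁ * (e (suc N) * (p₂ * p₂ * (e (suc (suc N)) * f (suc (suc N)))))
      f≈ n = ≡.trans (f-suc N n)
        (*-congˡ {p₁ * p₁} {e (suc N) * f (suc N)} {e (suc N) * (p₂ * p₂ * (e (suc (suc N)) * f (suc (suc N))))}
          (*-congˡ {e (suc N)} {f (suc N)} {p₂ * p₂ * (e (suc (suc N)) * f (suc (suc N)))} (f-suc (suc N))) n)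

    -- Up to degree 2M the squares of `V (M * 2)` and `V M` agree and can be cancelled.
    prefixProduct-f : ∀ M → prefixProduct e M * f (M ℕ.* 2) ≈[ M ℕ.* 2 ] O M * O M
    prefixProduct-f M = unit-cancelˡ-≤ {V (M ℕ.* 2) * V (M ℕ.* 2)} {V M * V M} {prefixProduct e M * f (M ℕ.* 2)} {O M * O M}
      (M ℕ.* 2) (≡.cong (λ a → a ℤ.* a) (V-0 (M ℕ.* 2)))
      (ℤ[[q]].⊛-cong-≤ {V (M ℕ.* 2)} {V M} {V (M ℕ.* 2)} {V M} (M ℕ.* 2) V≈ V≈) (λ {n} _ → telescoped M n)
      where
      V≈ : V (M ℕ.* 2) ≈[ M ℕ.* 2 ] V M
      V≈ {n} h = ≡.trans (≡.cong (λ m → V m n) (≡.trans (ℕ.*-comm M 2) (≡.cong (M ℕ.+_) (ℕ.+-identityʳ M)))) (V-stable M M h)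

  -- Two and three colors

  F₂ F₃ : ℕ → ℤ[[q]][[x]].Series
  F₂ N = momentSeries (replicate 2 N)
  F₃ N = momentSeries (replicate 3 N)

  e₂ e₃ : ℕ → ℤ[[q]].Series
  e₂ _ = 1#
  e₃ i = 1# - [-q]^ i

  F₂-0 : F₂ 0 ≋ A.1#
  F₂-0 = momentSeries-0 {0} (λ _ → ≡.trans (ℤ.*-identityˡ _) (ℤ.+-identityʳ _))
  F₃-0 : F₃ 0 ≋ A.1#
  F₃-0 = momentSeries-0 {1} (λ _ → ≡.trans (ℤ.*-identityˡ _) (ℤ.+-identityʳ _))

  F₂-suc : ∀ N → F₂ N ≋ pairFactor (suc N) ⊛ (const (e₂ (suc N)) ⊛ F₂ (suc N))
  F₂-suc N = A.trans {F₂ N} {pairFactor (suc N) ⊛ F₂ (suc N)} (momentSeries-step N [])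
    (A.*-congˡ {pairFactor (suc N)} {F₂ (suc N)} {A.1# ⊛ F₂ (suc N)}
      (A.sym {A.1# ⊛ F₂ (suc N)} {F₂ (suc N)} (A.*-identityˡ (F₂ (suc N)))))

  F₃-suc : ∀ N → F₃ N ≋ pairFactor (suc N) ⊛ (const (e₃ (suc N)) ⊛ F₃ (suc N))
  F₃-suc = momentSeries-step₃

  F₂₀-positive : ∀ M {n} → n ≤ suc M ℕ.* 2 → 0ℤ ℤ.< F₂ (suc M ℕ.* 2) 0 n
  F₂₀-positive M {n} h = ≡.subst (0ℤ ℤ.<_) (≡.sym eq) (O²-positive M h)
    where
    f : ℕ → ℤ[[q]].Series
    f N = F₂ N 0
    f-suc : ∀ N → f N ≈ (1# + [-q]^ (suc N)) * (1# + [-q]^ (suc N)) * (e₂ (suc N) * f (suc N))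
    f-suc N = F₂-suc N 0
    C : ℕ → ℤ[[q]].Series
    C = prefixProduct e₂
    C≈1 : ∀ M → C M ≈ 1#
    C≈1 zero    n = ≡.refl
    C≈1 (suc M) n = ≡.trans (*-identityʳ (C M * 1#) n) (≡.trans (*-identityʳ (C M) n) (C≈1 M n))
    eq : f (suc M ℕ.* 2) n ≡ (O (suc M) * O (suc M)) n
    eq = ≡.trans (≡.sym (≡.trans (*-congʳ {f (suc M ℕ.* 2)} {C (suc M)} {1#} (C≈1 (suc M)) n) (*-identityˡ (f (suc M ℕ.* 2)) n)))
      (prefixProduct-f f e₂ (F₂-0 0) f-suc (suc M) h)

  -- The third color makes `prefixProduct` equal to O V; cancelling one O from O V F_0 = O² leaves V
  -- F_0 = O, up to degree 2M + 2.
  F₃₀-positive : ∀ M {n} → n ≤ suc M ℕ.* 2 → 0ℤ ℤ.< F₃ (suc M ℕ.* 2) 0 n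
  F₃₀-positive M = V-quotient-positive M {f (suc M ℕ.* 2)} {O (suc M)} Vf
    (O-nonNeg (suc M)) (≡.subst (0ℤ ℤ.<_) (≡.sym (O-0 (suc M))) (ℤ.+<+ (s≤s z≤n))) (O-1 M)
    where
    open import Algebra.Solver.Ring.NaturalCoefficients.Default commutativeSemiring
      using (solve; _:*_; _:=_)
    f : ℕ → ℤ[[q]].Series
    f N = F₃ N 0
    f-suc : ∀ N → f N ≈ (1# + [-q]^ (suc N)) * (1# + [-q]^ (suc N)) * (e₃ (suc N) * f (suc N))
    f-suc N = F₃-suc N 0
    C : ℕ → ℤ[[q]].Series
    C = prefixProduct e₃
    rearrange : ∀ o v a b → o * v * a * b ≈ o * a * (v * b)
    rearrange = solve 4 (λ o v a b → o :* v :* a :* b := o :* a :* (v :* b)) refl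
    C≈OV : ∀ M → C M ≈ O M * V M
    C≈OV zero    n = ≡.sym (*-identityʳ 1# n)
    C≈OV (suc M) n = ≡.trans
      (*-congʳ {b} {C M * a} {O M * V M * a} (*-congʳ {a} {C M} {O M * V M} (C≈OV M)) n)
      (rearrange (O M) (V M) a b n)
      where
      a b : ℤ[[q]].Series
      a = 1# - [-q]^ (suc (M ℕ.* 2))
      b = 1# - [-q]^ (suc M ℕ.* 2)
    o v g : ℤ[[q]].Series
    o = O (suc M)
    v = V (suc M)
    g = f (suc M ℕ.* 2)
    Vf : v * g ≈[ suc M ℕ.* 2 ] o
    Vf = unit-cancelˡ-≤ {o} {o} {v * g} {o} (suc M ℕ.* 2) (O-0 (suc M)) (λ _ → ≡.refl)
      (λ {n} h → ≡.trans (≡.sym (≡.trans (*-congʳ {g} {C (suc M)} {o * v} (C≈OV (suc M)) n) (*-assoc o v g n)))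
        (prefixProduct-f f e₃ (F₃-0 0) f-suc (suc M) h))

  e₃-0 : ∀ N → e₃ (suc N) 0 ≡ 1ℤ
  e₃-0 N = ≡.cong (λ a → 1ℤ ℤ.- a) ([-q]^-0 N)

theorem3p2 : ∀ (n j : ℕ) → n ≥ j →
    (-1ℤ ℤ.^ n ℤ.* μ j 2 n ℤ.> 0ℤ) × (-1ℤ ℤ.^ n ℤ.* μ j 3 n ℤ.> 0ℤ)
theorem3p2 n j n≥j =
  ≡.subst (0ℤ ℤ.<_) (momentSeries-μ 0 j n≤N) (coefficients-positive {F₂ N} {L}
    (θ≋logDerivative F₂ e₂ F₂-0 (λ _ → ≡.refl) F₂-suc N) L₀ L≥0 L₁ (F₂₀-positive n) n≥j n≤N) ,
  ≡.subst (0ℤ ℤ.<_) (momentSeries-μ 1 j n≤N) (coefficients-positive {F₃ N} {L}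
    (θ≋logDerivative F₃ e₃ F₃-0 e₃-0 F₃-suc N)
    L₀ L≥0 L₁ (F₃₀-positive n) n≥j n≤N)
  where
  -- Even, as the pairing of indices demands, at least n, and nonzero even for n = 0, so that `Λ 1`
  -- is present.
  N = suc n ℕ.* 2
  L = logDerivative N
  L₀ = logDerivative-0 N
  L≥0 = logDerivative-nonNeg (suc n)
  L₁ = logDerivative-1-1 (suc (n ℕ.* 2))
  n≤N : n ≤ N
  n≤N = ℕ.≤-trans (ℕ.n≤1+n n) (ℕ.m≤m*n (suc n) 2)
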